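{- Let $s$ be a positive integer and $m$ a nonnegative integer. The number of self-conjugate $(s,s+1,s+2,s+3)$-core partitions with $m$ corners is \[ \binom{\lfloor \frac{s}{2}\rfloor-\lfloor \frac{m}{2} \rfloor}{\lfloor \frac{s}{2} \rfloor-m}\binom{\lfloor \frac{s+1}{2} \rfloor-\lfloor \frac{m+1}{2} \rfloor}{\lfloor \frac{m}{2} \rfloor}. \]
   Context: A partition is a finite (possibly empty) non-increasing sequence of positive integers, identified with its Young diagram. The number of corners of a partition is its number of distinct part sizes. The hook length of a box is the number of boxes to its right in the same row plus the number of boxes below it in the same column plus $1$. A partition is an $s$-core if no box has hook length $s$, and an $(s_1,\dots,s_q)$-core if it is an $s_i$-core for every $i$. A partition is self-conjugate if its Young diagram is invariant under reflection in the main diagonal. A binomial coefficient with negative lower entry is understood to be $0$. -}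

module Defs where

open import Data.Nat.Base as ℕ using (ℕ; zero; suc; _<_; _≥_; _∸_)
open import Data.Nat.Combinatorics using (_C_)
open import Data.Nat.Properties using (_≟_; _<?_)
open import Data.Integer.Base using (ℤ; +_; -[1+_]; 0ℤ; -1ℤ; _*_; _^_)
open import Data.List.Base using (List; []; _∷_; length; drop; filter; deduplicate)
open import Data.List.Membership.Propositional using (_∈_)
open import Data.List.Relation.Unary.All using (All)
open import Data.List.Relation.Unary.Linked using (Linked)
open import Data.List.Relation.Unary.Unique.Propositional using (Unique)
open import Data.Product.Base using (Σ-syntax; _×_)
open import Function.Bundles using (_⇔_)
open import Relation.Binary.PropositionalEquality using (_≡_; _≢_)

IsPartition : List ℕ → Set
IsPartition p = Linked _≥_ p × All (0 <_) p

-- Rows and columns are numbered from 0; rows past the last one have length 0.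
row : List ℕ → ℕ → ℕ
row []      _       = 0
row (x ∷ _) zero    = x
row (_ ∷ p) (suc i) = row p i

Box : List ℕ → ℕ → ℕ → Set
Box p i j = j < row p i

arm : List ℕ → ℕ → ℕ → ℕ
arm p i j = row p i ∸ suc j

-- Column j has one box in each row of length greater than j.
leg : List ℕ → ℕ → ℕ → ℕ
leg p i j = length (filter (j <?_) (drop (suc i) p))

-- Only meaningful when Box p i j holds.
hookLength : List ℕ → ℕ → ℕ → ℕ
hookLength p i j = arm p i j ℕ.+ leg p i j ℕ.+ 1

IsCore : ℕ → List ℕ → Set
IsCore s p = ∀ i j → Box p i j → hookLength p i j ≢ s

IsSimultaneousCore : List ℕ → List ℕ → Set
IsSimultaneousCore ss p = All (λ s → IsCore s p) ss

SelfConjugate : List ℕ → Set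
SelfConjugate p = ∀ i j → Box p i j ⇔ Box p j i

corners : List ℕ → ℕ
corners p = length (deduplicate _≟_ p)

-- Exactly n elements of A satisfy P, witnessed by a list of them without
-- repetitions.
HasCardinality : {A : Set} → (A → Set) → ℕ → Set
HasCardinality {A} P n =
  Σ[ xs ∈ List A ] Unique xs × (∀ x → x ∈ xs ⇔ P x) × length xs ≡ n

-- Binomial coefficient n(n-1)⋯(n-k+1)/k! for integers n and k, equal to 0 for
-- k < 0.  For a negative upper entry -N, with N = suc n, the value is
-- (-1)^k times the binomial coefficient of N + k - 1 over k.
binomial : ℤ → ℤ → ℤ
binomial _        -[1+ _ ] = 0ℤ
binomial (+ n)    (+ k)    = + (n C k)
binomial -[1+ n ] (+ k)    = -1ℤ ^ k * + ((n ℕ.+ k) C k)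

{-# OPTIONS --safe #-}
module Submission where

-- A self-conjugate partition is determined by the set A of the arms of its
-- diagonal boxes.  Seen as the set of beads at positions ≥ 0 of an abacus that
-- is antisymmetric under n ↦ -1 - n, it is a t-core iff the bead set is closed
-- under subtracting t.
--
-- Put the beads on s + 1 runners and let C n be the height of runner n.  The
-- core conditions for s, s + 2 and s + 3 say that C (n + 1) - C n is -1, 0 or 1
-- and that two consecutive differences are never both 1; the condition for
-- s + 1 and the antisymmetry give C (n + s + 1) = C n - 1 and C (s - n) = - C n.
-- So C is given by the word of its first k = ⌊ s /2⌋ differences, which leads
-- from C 0 ∈ {0, 1} to C k = 0.  With u rises it has u + C 0 falls, and the
-- partition has 2 u + C 0 corners.  Choosing the falls among the k - u letters
-- that are not rises, and inserting the rises into different gaps between these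
-- letters, gives the two binomial coefficients.

open import Defs
open import Data.Empty using (⊥; ⊥-elim)
open import Data.Integer.Base as ℤ using (ℤ; +_; -[1+_]; 0ℤ; 1ℤ; _-_; _*_; -_; +≤+)
import Data.Integer.Properties as ℤ
import Data.Integer.Tactic.RingSolver as ℤSolver
open import Data.List.Base
  using (List; []; _∷_; _++_; length; map; drop; filter; replicate; deduplicate; downFrom)
open import Data.List.Membership.Propositional using (_∈_; _∉_)
open import Data.List.Membership.Propositional.Properties
  using (∈-∃++; ∈-++⁻; ∈-++⁺ˡ; ∈-++⁺ʳ; ∈-map⁺; ∈-map⁻; ∈-filter⁺; ∈-filter⁻; ∈-downFrom⁺)
import Data.List.Properties as List
open import Data.List.Relation.Binary.Disjoint.Propositional using (Disjoint)
open import Data.List.Relation.Unary.All as All using (All; []; _∷_)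
import Data.List.Relation.Unary.All.Properties as All
open import Data.List.Relation.Unary.AllPairs as AllPairs using (AllPairs; []; _∷_)
import Data.List.Relation.Unary.AllPairs.Properties as AllPairs
open import Data.List.Relation.Unary.Any using (here; there)
open import Data.List.Relation.Unary.Linked as Linked using (Linked; []; [-]; _∷_)
import Data.List.Relation.Unary.Linked.Properties as Linked
open import Data.List.Relation.Unary.Unique.Propositional using (Unique)
import Data.List.Relation.Unary.Unique.Propositional.Properties as Unique
open import Data.Nat.Base as ℕ
  using (ℕ; zero; suc; pred; _+_; _∸_; _≤_; _<_; _≥_; _>_; z≤n; s≤s; NonZero; ⌊_/2⌋)
open import Data.Nat.Combinatorics
  using (k>n⇒nCk≡0; nCk+nC[k+1]≡[n+1]C[k+1]; nCk≡nC[n∸k])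
  renaming (_C_ to _choose_)
open import Data.Nat.DivMod
  using (_%_; _/_; m≡m%n+[m/n]*n; [m+kn]%n≡m%n; m≤n⇒m%n≡m; m%n<n; m<n⇒m/n≡0; m*n/n≡m;
    +-distrib-/-∣ʳ)
open import Data.Nat.Divisibility using (n∣m*n)
open import Data.Nat.Properties as ℕ using (_≟_; _<?_; _≤?_)
open import Data.List.Membership.DecPropositional _≟_ using (_∈?_)
import Data.Nat.Tactic.RingSolver as ℕSolver
open import Data.Product.Base using (Σ-syntax; ∃; ∃-syntax; _×_; _,_; proj₁; proj₂)
open import Data.Sum.Base using (_⊎_; inj₁; inj₂)
open import Function.Base using (_∘_; id; case_of_)
open import Function.Bundles using (_⇔_; mk⇔; Equivalence)
import Function.Properties.Equivalence as ⇔
open import Relation.Binary.Definitions using (tri<; tri≈; tri>)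
open import Relation.Binary.PropositionalEquality
open import Relation.Nullary using (¬_; ¬?; Dec; yes; no; contradiction; decidable-stable)

open Equivalence using (to; from)

-- Everything rests on one computation: `(n + 1) + (s + 1) h` minus `s + 2` is the position of
-- height `h - 1` on runner `n`, so closure under subtracting `s + 2` reads `C (n + 1) ≤ C n + 1`.
-- In the same way `s` bounds the falls, and `s + 3` compares `n + 2` with `n`. The same
-- inequalities at the ends of a half period restrict the word. The step from `s` to `s + 1` leads
-- from `- C 0` to `C 0 - 1`, hence `C 0` is 0 or 1; if it is 1, that step is itself a rise and the
-- word cannot begin with another. In the middle, an even `s` puts the mirror image directly after
-- the word, so a final rise would be doubled; for odd `s` a flat step separates the two. So the
-- number of gaps open to rises depends on `C 0` and on the parity of `s`, which is the source of
-- the floors in the second binomial coefficient. Rises count corners because an interval of beads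
-- avoiding 0 starts where the height, less the number of completed laps, passes from 0 to 1. A rise
-- of the word does this on exactly one lap, either itself or as its mirror image.

-- Certificate for b - a = (y - x) + c.
linear-≤ : ∀ {x y a b} c → x ≤ y → b + x ≡ a + y + c → a ≤ b
linear-≤ {x} {y} {a} {b} c x≤y eq = ℕ.+-cancelʳ-≤ y a b (begin
  a + y      ≤⟨ ℕ.m≤m+n (a + y) c ⟩
  a + y + c  ≡⟨ eq ⟨
  b + x      ≤⟨ ℕ.+-monoʳ-≤ b x≤y ⟩
  b + y      ∎)
  where open ℕ.≤-Reasoning

<-extensional : ∀ {a b} → (∀ x → x < a ⇔ x < b) → a ≡ b
<-extensional {a} {b} h with ℕ.<-cmp a b
... | tri< a<b _ _ = ⊥-elim (ℕ.<-irrefl refl (from (h a) a<b))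
... | tri≈ _ a≡b _ = a≡b
... | tri> _ _ b<a = ⊥-elim (ℕ.<-irrefl refl (to (h b) b<a))

-- Rows, columns and hook lengths

row-drop : ∀ k p i → row (drop k p) i ≡ row p (k + i)
row-drop zero    p       i = refl
row-drop (suc k) []      i = refl
row-drop (suc k) (x ∷ p) i = row-drop k p i

row-≤ : ∀ {x p} → All (x ≥_) p → ∀ i → row p i ≤ x
row-≤ []          i       = z≤n
row-≤ (x≥y ∷ _)   zero    = x≥y
row-≤ (_ ∷ x≥ys)  (suc i) = row-≤ x≥ys i

row-beyond : ∀ p {i} → length p ≤ i → row p i ≡ 0
row-beyond []      _         = refl
row-beyond (_ ∷ p) (s≤s p≤i) = row-beyond p p≤i

row-positive⇒< : ∀ p i → 0 < row p i → i < length p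
row-positive⇒< p i 0<r with i <? length p
... | yes i<l = i<l
... | no i≮l  = contradiction (subst (0 <_) (row-beyond p (ℕ.≮⇒≥ i≮l)) 0<r) λ ()

<⇒row-positive : ∀ {p} → All (0 <_) p → ∀ {i} → i < length p → 0 < row p i
<⇒row-positive (0<x ∷ _)  {zero}  _         = 0<x
<⇒row-positive (_ ∷ 0<p)  {suc i} (s≤s i<l) = <⇒row-positive 0<p i<l

row-map-suc : ∀ p {i} → i < length p → row (map suc p) i ≡ suc (row p i)
row-map-suc (_ ∷ _) {zero}  _         = refl
row-map-suc (_ ∷ p) {suc i} (s≤s i<l) = row-map-suc p i<l

row-map-suc-≤ : ∀ p {a} → row p 0 ≤ a → row (map suc p) 0 ≤ suc a
row-map-suc-≤ []      _ = z≤n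
row-map-suc-≤ (_ ∷ _) h = s≤s h

row-map-pred : ∀ p i → row (map pred p) i ≡ pred (row p i)
row-map-pred []      i       = refl
row-map-pred (_ ∷ _) zero    = refl
row-map-pred (_ ∷ p) (suc i) = row-map-pred p i

row-++-zeros : ∀ p z i → row (p ++ replicate z 0) i ≡ row p i
row-++-zeros []      zero    i       = refl
row-++-zeros []      (suc z) zero    = refl
row-++-zeros []      (suc z) (suc i) = row-++-zeros [] z i
row-++-zeros (_ ∷ _) z       zero    = refl
row-++-zeros (_ ∷ p) z       (suc i) = row-++-zeros p z i

-- In a non-increasing list the entries above `j` form an initial segment, so their number is the
-- length of column `j`.
<-column : ∀ {p} → AllPairs _≥_ p → ∀ i j → i < length (filter (j <?_) p) ⇔ j < row p i
<-column {[]}    _          i j = mk⇔ (λ ()) (λ ())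
<-column {x ∷ p} (x≥p ∷ p≥) i j with j <? x
... | yes j<x = subst (λ l → i < length l ⇔ j < row (x ∷ p) i)
  (sym (List.filter-accept (j <?_) j<x)) (shifted i)
  where
  shifted : ∀ i → i < suc (length (filter (j <?_) p)) ⇔ j < row (x ∷ p) i
  shifted zero    = mk⇔ (λ _ → j<x) (λ _ → s≤s z≤n)
  shifted (suc i) = mk⇔ (to (<-column p≥ i j) ∘ ℕ.s≤s⁻¹) (s≤s ∘ from (<-column p≥ i j))
... | no j≮x  = subst (λ l → i < length l ⇔ j < row (x ∷ p) i)
  (sym (List.filter-reject (j <?_) j≮x))
  (mk⇔ (⊥-elim ∘ below x≥p i ∘ to (<-column p≥ i j)) (⊥-elim ∘ below (ℕ.≤-refl ∷ x≥p) i))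
  where
  below : ∀ {q} → All (x ≥_) q → ∀ i → ¬ j < row q i
  below x≥q i lt = j≮x (ℕ.<-≤-trans lt (row-≤ x≥q i))

noninc : ∀ {p} → Linked _≥_ p → AllPairs _≥_ p
noninc = Linked.Linked⇒AllPairs (λ x≥y y≥z → ℕ.≤-trans y≥z x≥y)

<-∸ : ∀ o n {x} → x < n ∸ o ⇔ o + x < n
<-∸ zero    n       = mk⇔ id id
<-∸ (suc o) zero    = mk⇔ (λ ()) (λ ())
<-∸ (suc o) (suc n) = mk⇔ (s≤s ∘ to (<-∸ o n)) (from (<-∸ o n) ∘ ℕ.s≤s⁻¹)

-- Column `j` is as long as row `j`. This removes legs from the argument: a hook length becomes a
-- sum of two row lengths, corrected by `i + j`.
leg-selfConjugate : ∀ {p} → Linked _≥_ p → SelfConjugate p → ∀ i j → leg p i j ≡ row p j ∸ suc i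
leg-selfConjugate {p} p≥ sc i j = <-extensional λ x →
  ⇔.trans (column x) (⇔.trans (sc (suc i + x) j) (⇔.sym (<-∸ (suc i) (row p j))))
  where
  column : ∀ x → x < leg p i j ⇔ j < row p (suc i + x)
  column x = subst (λ r → x < leg p i j ⇔ j < r) (row-drop (suc i) p x)
               (<-column (AllPairs.drop⁺ (suc i) (noninc p≥)) x j)

-- Outside the diagram of a self-conjugate partition the two rows sum to at
-- most i + j, so the box condition may be dropped.
core⇔rows : ∀ {p} → Linked _≥_ p → SelfConjugate p → ∀ t →
  IsCore t p ⇔ (∀ i j → row p i + row p j ≢ suc (t + (i + j)))
core⇔rows {p} p≥ sc t = mk⇔ forwards backwards
  where
  hook : ∀ i j → Box p i j → suc (hookLength p i j + (i + j)) ≡ row p i + row p j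
  hook i j b = begin
    suc (row p i ∸ suc j + leg p i j + 1 + (i + j))
      ≡⟨ cong (λ l → suc (row p i ∸ suc j + l + 1 + (i + j))) (leg-selfConjugate p≥ sc i j) ⟩
    suc (row p i ∸ suc j + (row p j ∸ suc i) + 1 + (i + j))
      ≡⟨ regroup (row p i ∸ suc j) (row p j ∸ suc i) i j ⟩
    (row p i ∸ suc j + suc j) + (row p j ∸ suc i + suc i)
      ≡⟨ cong₂ _+_ (ℕ.m∸n+n≡m b) (ℕ.m∸n+n≡m (to (sc i j) b)) ⟩
    row p i + row p j ∎
    where
    open ≡-Reasoning
    regroup : ∀ a b i j → suc (a + b + 1 + (i + j)) ≡ (a + suc j) + (b + suc i)
    regroup = ℕSolver.solve-∀
  forwards : IsCore t p → ∀ i j → row p i + row p j ≢ suc (t + (i + j))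
  forwards core i j eq with j <? row p i
  ... | yes b = core i j b (ℕ.+-cancelʳ-≡ (i + j) _ _ (ℕ.suc-injective (trans (hook i j b) eq)))
  ... | no ¬b = ℕ.<-irrefl eq (s≤s (begin
    row p i + row p j  ≤⟨ ℕ.+-mono-≤ (ℕ.≮⇒≥ ¬b) (ℕ.≮⇒≥ (¬b ∘ from (sc i j))) ⟩
    j + i              ≡⟨ ℕ.+-comm j i ⟩
    i + j              ≤⟨ ℕ.m≤n+m (i + j) t ⟩
    t + (i + j)        ∎))
    where open ℕ.≤-Reasoning
  backwards : (∀ i j → row p i + row p j ≢ suc (t + (i + j))) → IsCore t p
  backwards h i j b refl = h i j (sym (hook i j b))

-- Self-conjugate partitions from their diagonal

Decreasing : List ℕ → Set
Decreasing = AllPairs _>_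

-- The self-conjugate partition whose diagonal boxes have arms as (equivalently
-- legs as): each step wraps a hook around the previous diagram.
selfConj : List ℕ → List ℕ
selfConj []       = []
selfConj (a ∷ as) = suc a ∷ map suc (selfConj as ++ replicate (a ∸ length (selfConj as)) 0)

-- Strict decrease keeps the inner diagram within `a` rows, so the truncated subtraction in the
-- padding is exact. The three length facts depend on each other and are proved by mutual induction.
length-selfConj : ∀ {a as} → Decreasing (a ∷ as) → length (selfConj (a ∷ as)) ≡ suc a
length-selfConj-≤ : ∀ {a as} → Decreasing (a ∷ as) → length (selfConj as) ≤ a

length-padded : ∀ {a as} → Decreasing (a ∷ as) →
  length (selfConj as ++ replicate (a ∸ length (selfConj as)) 0) ≡ a
length-padded {a} {as} d = begin
  length (selfConj as ++ replicate (a ∸ length (selfConj as)) 0)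
    ≡⟨ List.length-++ (selfConj as) ⟩
  length (selfConj as) + length (replicate (a ∸ length (selfConj as)) 0)
    ≡⟨ cong (_+_ (length (selfConj as))) (List.length-replicate (a ∸ length (selfConj as))) ⟩
  length (selfConj as) + (a ∸ length (selfConj as))
    ≡⟨ ℕ.m+[n∸m]≡n (length-selfConj-≤ d) ⟩
  a ∎
  where open ≡-Reasoning

length-selfConj {a} {as} d = cong suc (trans (List.length-map suc (selfConj as ++ _))
  (length-padded d))

length-selfConj-≤ {as = []}    d                  = z≤n
length-selfConj-≤ {as = _ ∷ _} ((a>b ∷ _) ∷ ds) = ℕ.≤-trans (ℕ.≤-reflexive (length-selfConj ds)) a>b

row-selfConj-inside : ∀ {a as} → Decreasing (a ∷ as) → ∀ {i} → i < a →
  row (selfConj (a ∷ as)) (suc i) ≡ suc (row (selfConj as) i)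
row-selfConj-inside {a} {as} d {i} i<a =
  trans (row-map-suc (selfConj as ++ _) (subst (i <_) (sym (length-padded d)) i<a))
        (cong suc (row-++-zeros (selfConj as) _ i))

row-selfConj-outside : ∀ {a as} → Decreasing (a ∷ as) → ∀ {i} → a ≤ i →
  row (selfConj (a ∷ as)) (suc i) ≡ 0
row-selfConj-outside {a} {as} d {i} a≤i =
  row-beyond (selfConj (a ∷ as)) (subst (_≤ suc i) (sym (length-selfConj d)) (s≤s a≤i))

-- The first row and the first column both have `suc a` boxes, and deleting them leaves the previous
-- diagram, where induction applies.
selfConj-selfConjugate : ∀ {as} → Decreasing as → SelfConjugate (selfConj as)
selfConj-selfConjugate []           i       j       = mk⇔ (λ ()) (λ ())
selfConj-selfConjugate {a ∷ as} d@(_ ∷ ds) = symmetric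
  where
  firstColumn : ∀ i → Box (selfConj (a ∷ as)) i 0 ⇔ i < suc a
  firstColumn i = mk⇔
    (λ b → subst (i <_) (length-selfConj d) (row-positive⇒< (selfConj (a ∷ as)) i b))
    (back i)
    where
    back : ∀ i → i < suc a → Box (selfConj (a ∷ as)) i 0
    back zero    _         = s≤s z≤n
    back (suc i) (s≤s i<a) = subst (0 <_) (sym (row-selfConj-inside d i<a)) (s≤s z≤n)
  inner : ∀ i j → Box (selfConj (a ∷ as)) (suc i) (suc j) ⇔ Box (selfConj as) i j
  inner i j with i <? a
  ... | yes i<a = mk⇔ (λ b → ℕ.s≤s⁻¹ (subst (suc j <_) (row-selfConj-inside d i<a) b))
                      (λ b → subst (suc j <_) (sym (row-selfConj-inside d i<a)) (s≤s b))
  ... | no i≮a  = mk⇔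
    (λ b → contradiction (subst (suc j <_) (row-selfConj-outside d (ℕ.≮⇒≥ i≮a)) b) λ ())
    (λ b → contradiction
      (ℕ.<-≤-trans (row-positive⇒< (selfConj as) i (ℕ.≤-<-trans z≤n b)) (length-selfConj-≤ d)) i≮a)
  symmetric : SelfConjugate (selfConj (a ∷ as))
  symmetric zero    j       = ⇔.sym (firstColumn j)
  symmetric (suc i) zero    = firstColumn (suc i)
  symmetric (suc i) (suc j) = ⇔.trans (inner i j)
    (⇔.trans (selfConj-selfConjugate ds i j) (⇔.sym (inner j i)))

row-selfConj-< : ∀ {as a} → All (a >_) as → row (selfConj as) 0 ≤ a
row-selfConj-< []        = z≤n
row-selfConj-< (a>b ∷ _) = a>b

Linked-++-zeros : ∀ {p} → Linked _≥_ p → ∀ z → Linked _≥_ (p ++ replicate z 0)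
Linked-++-zeros []        zero          = []
Linked-++-zeros []        (suc zero)    = [-]
Linked-++-zeros []        (suc (suc z)) = z≤n ∷ Linked-++-zeros [] (suc z)
Linked-++-zeros [-]       zero          = [-]
Linked-++-zeros [-]       (suc z)       = z≤n ∷ Linked-++-zeros [] (suc z)
Linked-++-zeros (h ∷ p≥)  z             = h ∷ Linked-++-zeros p≥ z

Linked-∷ : ∀ {x p} → row p 0 ≤ x → Linked _≥_ p → Linked _≥_ (x ∷ p)
Linked-∷ {p = []}    h p≥ = [-]
Linked-∷ {p = _ ∷ _} h p≥ = h ∷ p≥

selfConj-isPartition : ∀ {as} → Decreasing as → IsPartition (selfConj as)
selfConj-isPartition []           = [] , []
selfConj-isPartition {a ∷ as} (a>as ∷ ds) =
  Linked-∷ (row-map-suc-≤ (selfConj as ++ zs)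
    (ℕ.≤-trans (ℕ.≤-reflexive (row-++-zeros (selfConj as) _ 0)) (row-selfConj-< a>as)))
           (Linked.map⁺ (Linked.map s≤s (Linked-++-zeros (proj₁ (selfConj-isPartition ds)) _)))
  , s≤s z≤n ∷ All.map⁺ (All.universal (λ _ → s≤s z≤n) (selfConj as ++ zs))
  where
  zs : List ℕ
  zs = replicate (a ∸ length (selfConj as)) 0

selfConj-injective : ∀ {as bs} → Decreasing as → Decreasing bs → selfConj as ≡ selfConj bs → as ≡ bs
selfConj-injective {[]}     {[]}     _ _ _  = refl
selfConj-injective {a ∷ as} {b ∷ bs} (_ ∷ das) (_ ∷ dbs) eq =
  cong₂ _∷_ (ℕ.suc-injective (List.∷-injectiveˡ eq))
    (selfConj-injective das dbs
      (unpad (proj₂ (selfConj-isPartition das)) (proj₂ (selfConj-isPartition dbs)) _ _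
        (List.map-injective ℕ.suc-injective (List.∷-injectiveʳ eq))))
  where
  -- Parts are positive, so the first zero marks where the padding starts.
  unpad : ∀ {p q} → All (0 <_) p → All (0 <_) q → ∀ y z → p ++ replicate y 0 ≡ q ++ replicate z 0 →
    p ≡ q
  unpad {[]}    {[]}    _ _ _ _ _ = refl
  unpad {[]}    {_ ∷ _} _ (0<x ∷ _) (suc y) z eq = contradiction (List.∷-injectiveˡ eq) (ℕ.<⇒≢ 0<x)
  unpad {_ ∷ _} {[]}    (0<x ∷ _) _ y (suc z) eq = contradiction (sym (List.∷-injectiveˡ eq))
    (ℕ.<⇒≢ 0<x)
  unpad {_ ∷ _} {_ ∷ _} (_ ∷ 0<p) (_ ∷ 0<q) y z eq =
    cong₂ _∷_ (List.∷-injectiveˡ eq) (unpad 0<p 0<q y z (List.∷-injectiveʳ eq))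

-- Removing the first column of a partition can empty some rows; this separates them from the
-- genuine parts.
unpadded : ∀ {q} → Linked _≥_ q → ∃[ p ] ∃[ z ] IsPartition p × q ≡ p ++ replicate z 0
unpadded {[]}         _  = [] , 0 , ([] , []) , refl
unpadded {zero ∷ q}   q≥ = [] , suc (length q) , ([] , []) ,
  cong (0 ∷_) (zeros (λ i → row-≤ (AllPairs.head (noninc q≥)) i))
  where
  zeros : ∀ {q} → (∀ i → row q i ≤ 0) → q ≡ replicate (length q) 0
  zeros {[]}    _ = refl
  zeros {x ∷ q} h = cong₂ _∷_ (ℕ.n≤0⇒n≡0 (h 0)) (zeros (h ∘ suc))
unpadded {suc x ∷ q} q≥ with unpadded (Linked.tail q≥)
... | p , z , (p≥ , 0<p) , refl = suc x ∷ p , z ,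
  (Linked-∷ (subst (_≤ suc x) (row-++-zeros p z 0) (row-≤ (AllPairs.head (noninc q≥)) 0)) p≥ ,
    s≤s z≤n ∷ 0<p) , refl

-- The hook of the first diagonal box is peeled off repeatedly. What remains is not a sublist of
-- `p`, so the recursion runs on a bound for the number of rows.
selfConj-surjective : ∀ {p} → IsPartition p → SelfConjugate p → ∃[ as ] Decreasing as ×
  selfConj as ≡ p
selfConj-surjective {p} = go (length p) p ℕ.≤-refl
  where
  go : ∀ n p → length p ≤ n → IsPartition p → SelfConjugate p → ∃[ as ] Decreasing as ×
    selfConj as ≡ p
  go n       []           _         _          _  = [] , [] , refl
  go (suc n) (suc a ∷ p') (s≤s p'≤n) (p≥ , _ ∷ 0<p') sc
    with unpadded (Linked.map⁺ (Linked.map ℕ.pred-mono-≤ (Linked.tail p≥)))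
  ... | q , z , isP , eq = step
    (go n q (ℕ.≤-trans (ℕ.m≤m+n (length q) z) (ℕ.≤-trans (ℕ.≤-reflexive lengths) p'≤n)) isP sc')
    where
    lengths : length q + z ≡ length p'
    lengths = trans (sym (trans (List.length-++ q)
      (cong (_+_ (length q)) (List.length-replicate z))))
                (trans (cong length (sym eq)) (List.length-map pred p'))
    -- Symmetry of the first row and the first column; it shows that the stripped zeros are exactly
    -- those that `selfConj` puts back.
    length≡ : length p' ≡ a
    length≡ = <-extensional λ x → mk⇔
      (λ lt → ℕ.s≤s⁻¹ (from (sc 0 (suc x)) (<⇒row-positive 0<p' lt)))
      (λ lt → row-positive⇒< p' x (to (sc 0 (suc x)) (s≤s lt)))
    rows : ∀ i → row q i ≡ pred (row p' i)
    rows i = trans (sym (trans (cong (λ l → row l i) eq) (row-++-zeros q z i))) (row-map-pred p' i)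
    boxes : ∀ i j → Box q i j ⇔ Box (suc a ∷ p') (suc i) (suc j)
    boxes i j = subst (λ r → j < r ⇔ suc j < row p' i) (sym (rows i)) (below-pred (row p' i))
      where
      below-pred : ∀ r → j < pred r ⇔ suc j < r
      below-pred zero    = mk⇔ (λ ()) (λ ())
      below-pred (suc r) = mk⇔ s≤s ℕ.s≤s⁻¹
    sc' : SelfConjugate q
    sc' i j = ⇔.trans (boxes i j) (⇔.trans (sc (suc i) (suc j)) (⇔.sym (boxes j i)))
    step : ∃[ as ] Decreasing as × selfConj as ≡ q → ∃[ as ] Decreasing as × selfConj as ≡ suc a ∷
      p'
    step (as , das , refl) = a ∷ as ,
      larger das (ℕ.≤-trans (ℕ.≤-reflexive (rows 0))
      (ℕ.pred-mono-≤ (row-≤ (AllPairs.head (noninc p≥)) 0))) ∷ das ,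
      cong (suc a ∷_) (begin
        map suc (selfConj as ++ replicate (a ∸ length (selfConj as)) 0)
          ≡⟨ cong (λ y → map suc (selfConj as ++ replicate y 0)) padding ⟩
        map suc (selfConj as ++ replicate z 0)
          ≡⟨ cong (map suc) eq ⟨
        map suc (map pred p')
          ≡⟨ suc-pred 0<p' ⟩
        p' ∎)
      where
      open ≡-Reasoning
      padding : a ∸ length (selfConj as) ≡ z
      padding = trans (cong (_∸ length (selfConj as)) (sym (trans lengths length≡)))
        (ℕ.m+n∸m≡n (length (selfConj as)) z)
      larger : ∀ {as} → Decreasing as → row (selfConj as) 0 ≤ a → All (a >_) as
      larger []            _   = []
      larger (b>bs ∷ _)    b<a = b<a ∷ All.map (λ b>c → ℕ.<-trans b>c b<a) b>bs
      suc-pred : ∀ {p} → All (0 <_) p → map suc (map pred p) ≡ p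
      suc-pred []                = refl
      suc-pred (s≤s z≤n ∷ 0<p) = cong₂ _∷_ refl (suc-pred 0<p)

-- Bead positions of the rows, and cores as sets closed under subtraction

bead⁺ : ∀ {as n} → Decreasing as → n ∈ as → ∃[ i ] row (selfConj as) i ≡ suc (i + n)
bead⁺ _ (here refl) = 0 , refl
bead⁺ {a ∷ as} d@(_ ∷ ds) (there n∈as) with bead⁺ ds n∈as
... | i , eq = suc i , trans (row-selfConj-inside d i<a) (cong suc eq)
  where
  i<a : i < a
  i<a = ℕ.<-≤-trans (row-positive⇒< (selfConj as) i (subst (0 <_) (sym eq) (s≤s z≤n)))
    (length-selfConj-≤ d)

bead⁺⁻¹ : ∀ {as n} → Decreasing as → ∀ i → row (selfConj as) i ≡ suc (i + n) → n ∈ as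
bead⁺⁻¹ {a ∷ as} d        zero    eq = here (sym (ℕ.suc-injective eq))
bead⁺⁻¹ {a ∷ as} d@(_ ∷ ds) (suc i) eq with i <? a
... | yes i<a = there (bead⁺⁻¹ ds i (ℕ.suc-injective (trans (sym (row-selfConj-inside d i<a)) eq)))
... | no i≮a  = contradiction (trans (sym (row-selfConj-outside d (ℕ.≮⇒≥ i≮a))) eq) λ ()

-- Row `i` has its bead at `row i - i - 1`. The nonnegative beads are the elements of `as`; the
-- equation here places the bead at `-1 - n`. Additive equations avoid truncated subtraction.
bead⁻ : ∀ {as n} → Decreasing as → n ∉ as → ∃[ i ] row (selfConj as) i + n ≡ i
bead⁻ {[]}     {n} _ _ = n , refl
bead⁻ {a ∷ as} {n} d@(_ ∷ ds) n∉ with bead⁻ ds (n∉ ∘ there)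
... | i , eq with i <? a
...   | yes i<a = suc i , trans (cong (_+ n) (row-selfConj-inside d i<a)) (cong suc eq)
-- The inner row `i` is empty, so `n` equals `i` and is at least `a`. Since `n` differs from `a`,
-- row `n` of the new diagram is empty too and carries the bead.
...   | no i≮a  = outside (ℕ.≤∧≢⇒< (subst (a ≤_) (sym n≡i) a≤i) (n∉ ∘ here ∘ sym))
  where
  a≤i : a ≤ i
  a≤i = ℕ.≮⇒≥ i≮a
  zero-row : row (selfConj as) i ≡ 0
  zero-row = row-beyond (selfConj as) (ℕ.≤-trans (length-selfConj-≤ d) a≤i)
  n≡i : n ≡ i
  n≡i = trans (cong (_+ n) (sym zero-row)) eq
  outside : ∀ {n} → a < n → ∃[ i ] row (selfConj (a ∷ as)) i + n ≡ i
  outside (s≤s {n = n} a≤n) = suc n , cong (_+ suc n) (row-selfConj-outside d a≤n)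

bead⁻⁻¹ : ∀ {as n} → Decreasing as → ∀ i → row (selfConj as) i + n ≡ i → n ∉ as
bead⁻⁻¹ {a ∷ as} {n} d@(a>as ∷ ds) (suc i) eq with i <? a
... | yes i<a = λ { (here refl)  → ℕ.<⇒≱ i<a (subst (a ≤_) below (ℕ.m≤n+m a _))
                  ; (there n∈as) → bead⁻⁻¹ ds i below n∈as }
  where
  below : row (selfConj as) i + n ≡ i
  below = ℕ.suc-injective (trans (cong (_+ n) (sym (row-selfConj-inside d i<a))) eq)
... | no i≮a  = λ { (here refl)  → ℕ.<⇒≱ a<n ℕ.≤-refl
                  ; (there n∈as) → ℕ.<-asym a<n (All.lookup a>as n∈as) }
  where
  a<n : a < n
  a<n = subst (a <_) (trans (sym eq) (cong (_+ n) (row-selfConj-outside d (ℕ.≮⇒≥ i≮a))))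
    (s≤s (ℕ.≮⇒≥ i≮a))

-- Closure of all beads under subtracting `t`, expressed on the nonnegative ones. If `n - t` is
-- negative, it is `-1 - n'` and must be a bead, so `n'` must be absent: this is the first clause.
-- The second clause covers shifts within one sign; for negative beads it is read as its
-- contrapositive.
CoreSet : ℕ → List ℕ → Set
CoreSet t as = (∀ n n' → n ∈ as → n' ∈ as → suc (n + n') ≢ t)
             × (∀ n → n + t ∈ as → n ∈ as)

-- With `b i = row i - i - 1`, a hook of length `t` means `b i - t = -1 - b j`: subtracting `t` from
-- a bead hits the mirror image of a bead, which is a gap. The cases are the signs of the two beads.
core⇔coreSet : ∀ {as} → Decreasing as → ∀ t → IsCore t (selfConj as) ⇔ CoreSet t as
core⇔coreSet {as} d t =
  ⇔.trans (core⇔rows (proj₁ (selfConj-isPartition d)) (selfConj-selfConjugate d) t)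
    (mk⇔ forwards backwards)
  where
  r : ℕ → ℕ
  r = row (selfConj as)
  forwards : (∀ i j → r i + r j ≢ suc (t + (i + j))) → CoreSet t as
  forwards h = sums , shifts
    where
    sums : ∀ n n' → n ∈ as → n' ∈ as → suc (n + n') ≢ t
    sums n n' n∈ n'∈ refl with bead⁺ d n∈ | bead⁺ d n'∈
    ... | i , eq | j , eq' = h i j (trans (cong₂ _+_ eq eq') (regroup i j n n'))
      where
      regroup : ∀ i j n n' → suc (i + n) + suc (j + n') ≡ suc (suc (n + n') + (i + j))
      regroup = ℕSolver.solve-∀
    shifts : ∀ n → n + t ∈ as → n ∈ as
    shifts n n+t∈ with n ∈? as
    ... | yes n∈ = n∈
    ... | no n∉ with bead⁺ d n+t∈ | bead⁻ d n∉
    ...   | i , eq | j , eq' = ⊥-elim (h i j (ℕ.+-cancelʳ-≡ n _ _ (begin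
      r i + r j + n                ≡⟨ ℕ.+-assoc (r i) (r j) n ⟩
      r i + (r j + n)              ≡⟨ cong₂ _+_ eq eq' ⟩
      suc (i + (n + t)) + j        ≡⟨ regroup i j n t ⟩
      suc (t + (i + j)) + n        ∎)))
      where
      open ≡-Reasoning
      regroup : ∀ i j n t → suc (i + (n + t)) + j ≡ suc (t + (i + j)) + n
      regroup = ℕSolver.solve-∀
  -- Each row is either i + 1 + n with n in as, or i - x with x outside as.
  mixed : CoreSet t as → ∀ i j → r i + r j ≡ suc (t + (i + j)) → i < r i → r j ≤ j → ⊥
  mixed (_ , shifts) i j eq i<ri rj≤j with ℕ.m≤n⇒∃[o]m+o≡n rj≤j
  ... | x , e = bead⁻⁻¹ d j e (shifts x (bead⁺⁻¹ d i (ℕ.+-cancelʳ-≡ (r j) _ _ (begin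
    r i + r j                     ≡⟨ eq ⟩
    suc (t + (i + j))             ≡⟨ cong (λ y → suc (t + (i + y))) e ⟨
    suc (t + (i + (r j + x)))     ≡⟨ regroup t i (r j) x ⟩
    suc (i + (x + t)) + r j       ∎))))
    where
    open ≡-Reasoning
    regroup : ∀ t i y x → suc (t + (i + (y + x))) ≡ suc (i + (x + t)) + y
    regroup = ℕSolver.solve-∀
  backwards : CoreSet t as → ∀ i j → r i + r j ≢ suc (t + (i + j))
  backwards (sums , shifts) i j eq with ℕ.≤-<-connex (r i) i | ℕ.≤-<-connex (r j) j
  ... | inj₁ ri≤i | inj₁ rj≤j =
    ℕ.<-irrefl eq (s≤s (ℕ.≤-trans (ℕ.+-mono-≤ ri≤i rj≤j) (ℕ.m≤n+m (i + j) t)))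
  ... | inj₂ i<ri | inj₂ j<rj with ℕ.m≤n⇒∃[o]m+o≡n i<ri | ℕ.m≤n⇒∃[o]m+o≡n j<rj
  ...   | n , e | n' , e' = sums n n' (bead⁺⁻¹ d i (sym e)) (bead⁺⁻¹ d j (sym e'))
    (ℕ.+-cancelʳ-≡ (suc (i + j)) _ _ (begin
      suc (n + n') + suc (i + j)     ≡⟨ regroup n n' i j ⟩
      suc i + n + (suc j + n')       ≡⟨ cong₂ _+_ e e' ⟩
      r i + r j                      ≡⟨ eq ⟩
      suc (t + (i + j))              ≡⟨ ℕ.+-suc t (i + j) ⟨
      t + suc (i + j)                ∎))
    where
    open ≡-Reasoning
    regroup : ∀ n n' i j → suc (n + n') + suc (i + j) ≡ suc i + n + (suc j + n')
    regroup = ℕSolver.solve-∀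
  backwards c i j eq | inj₂ i<ri | inj₁ rj≤j = mixed c i j eq i<ri rj≤j
  backwards c i j eq | inj₁ ri≤i | inj₂ j<rj =
    mixed c j i (trans (ℕ.+-comm (r j) (r i)) (trans eq (cong (λ y → suc (t + y)) (ℕ.+-comm i j))))
      j<rj ri≤i

-- Corners

-- Lower ends of the maximal intervals of consecutive elements, apart from 0. In a decreasing list a
-- predecessor can only stand further right, so searching the tail suffices.
starts : List ℕ → List ℕ
starts []           = []
starts (zero ∷ as)  = starts as
starts (suc a ∷ as) with a ∈? as
... | yes _ = starts as
... | no _  = suc a ∷ starts as

-- Counts the corner on the main diagonal: the innermost diagonal box is a corner exactly when its
-- arm is 0.
origin : List ℕ → ℕ
origin as with 0 ∈? as
... | yes _ = 1
... | no _  = 0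

corners-repeat : ∀ x p → corners (x ∷ x ∷ p) ≡ corners (x ∷ p)
corners-repeat x p = cong (suc ∘ length)
  (trans (List.filter-reject (¬? ∘ (x ≟_)) (λ x≢x → x≢x refl))
    (List.filter-idem (¬? ∘ (x ≟_)) (deduplicate _≟_ p)))

corners-new : ∀ {x p} → All (x ≢_) p → corners (x ∷ p) ≡ suc (corners p)
corners-new {x} x∉p = cong (suc ∘ length) (List.filter-all (¬? ∘ (x ≟_)) (All.deduplicate⁺ _≟_ x∉p))

corners-larger : ∀ {x p} → row p 0 < x → Linked _≥_ p → corners (x ∷ p) ≡ suc (corners p)
corners-larger {p = []}    _   _  = refl
corners-larger {p = _ ∷ _} y<x p≥ =
  corners-new ((ℕ.>⇒≢ y<x) ∷ All.map (λ y≥z → ℕ.>⇒≢ (ℕ.≤-<-trans y≥z y<x))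
    (AllPairs.head (noninc p≥)))

corners-map-suc : ∀ {p} → Linked _≥_ p → corners (map suc p) ≡ corners p
corners-map-suc {[]}        _  = refl
corners-map-suc {_ ∷ []}    _  = refl
corners-map-suc {x ∷ y ∷ p} (x≥y ∷ p≥) with x ≟ y
... | yes refl = trans (corners-repeat (suc x) (map suc p))
  (trans (corners-map-suc p≥) (sym (corners-repeat x p)))
... | no x≢y   = trans (corners-larger (s≤s y<x) (Linked.map⁺ (Linked.map s≤s p≥)))
                   (trans (cong suc (corners-map-suc p≥)) (sym (corners-larger y<x p≥)))
  where
  y<x : y < x
  y<x = ℕ.≤∧≢⇒< x≥y (x≢y ∘ sym)

corners-++-zeros : ∀ {p} → Linked _≥_ p → All (0 <_) p → ∀ z →
  corners (p ++ replicate (suc z) 0) ≡ suc (corners p)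
corners-++-zeros {[]}     _  _         zero    = refl
corners-++-zeros {[]}     _  _         (suc z) = trans (corners-repeat 0 (replicate z 0))
  (corners-++-zeros [] [] z)
corners-++-zeros {x ∷ []} _  (0<x ∷ _)   z       =
  trans (corners-larger 0<x (Linked-++-zeros [] (suc z))) (cong suc (corners-++-zeros [] [] z))
corners-++-zeros {x ∷ y ∷ p} (x≥y ∷ p≥) (_ ∷ 0<p) z with x ≟ y
... | yes refl = trans (corners-repeat x (p ++ replicate (suc z) 0))
                   (trans (corners-++-zeros p≥ 0<p z) (cong suc (sym (corners-repeat x p))))
... | no x≢y   = trans (corners-larger y<x (Linked-++-zeros p≥ (suc z)))
                   (cong suc (trans (corners-++-zeros p≥ 0<p z) (sym (corners-larger y<x p≥))))
  where
  y<x : y < x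
  y<x = ℕ.≤∧≢⇒< x≥y (x≢y ∘ sym)

∈-starts : ∀ {as} → Decreasing as → ∀ n → n ∈ starts as ⇔ (n ∈ as × ∃[ n' ] n ≡ suc n' × n' ∉ as)
∈-starts {[]}         _ n = mk⇔ (λ ()) λ ()
∈-starts {zero ∷ []}  _ n = mk⇔ (λ ()) λ { (here refl , _ , () , _) }
∈-starts {zero ∷ b ∷ as} ((() ∷ _) ∷ _) n
∈-starts {suc a ∷ as} (a>as ∷ ds) n with a ∈? as
... | yes a∈ = mk⇔
  (λ n∈ → case to (∈-starts ds n) n∈ of λ
    { (n∈as , n' , refl , n'∉) → there n∈as , n' , refl , λ
      { (here refl) → ℕ.<-asym (All.lookup a>as n∈as) (ℕ.n<1+n _) ; (there n'∈) → n'∉ n'∈ } })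
  λ { (here refl , _ , refl , n'∉) → contradiction (there a∈) n'∉
    ; (there n∈ , n' , refl , n'∉) → from (∈-starts ds n) (n∈ , n' , refl , n'∉ ∘ there) }
... | no a∉  = mk⇔
  (λ { (here refl) → here refl , a , refl , λ { (here a≡) → ℕ.1+n≢n (sym a≡) ; (there a∈) → a∉ a∈ }
     ; (there n∈)  → case to (∈-starts ds n) n∈ of λ
    { (n∈as , n' , refl , n'∉) → there n∈as , n' , refl , λ
      { (here refl) → ℕ.<-asym (All.lookup a>as n∈as) (ℕ.n<1+n _) ; (there n'∈) → n'∉ n'∈ } } })
  λ { (here refl , _ , refl , n'∉) → here refl
    ; (there n∈ , n' , refl , n'∉) → there (from (∈-starts ds n) (n∈ , n' , refl , n'∉ ∘ there)) }

starts-unique : ∀ {as} → Decreasing as → Unique (starts as)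
starts-unique []                         = []
starts-unique {zero ∷ as}  (_ ∷ ds)      = starts-unique ds
starts-unique {suc a ∷ as} (a>as ∷ ds) with a ∈? as
... | yes _ = starts-unique ds
... | no _  = All.tabulate (λ n∈ → ℕ.>⇒≢ (All.lookup a>as (proj₁ (to (∈-starts ds _) n∈)))) ∷
  starts-unique ds

origin-suc : ∀ a as → origin (suc a ∷ as) ≡ origin as
origin-suc a as with 0 ∈? as | 0 ∈? (suc a ∷ as)
... | yes _  | yes _          = refl
... | no _   | no _           = refl
... | no 0∉  | yes (there 0∈) = contradiction 0∈ 0∉
... | yes 0∈ | no 0∉          = contradiction (there 0∈) 0∉

-- Corners off the diagonal come in mirror pairs, one pair for each maximal
-- interval of as that avoids 0.
corners-selfConj : ∀ {as} → Decreasing as →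
  corners (selfConj as) ≡ origin as + (length (starts as) + length (starts as))
corners-selfConj {[]}            _              = refl
corners-selfConj {zero ∷ []}     _              = refl
corners-selfConj {zero ∷ b ∷ as} ((() ∷ _) ∷ _)
corners-selfConj {suc a ∷ as} d@(a>as ∷ ds) with a ∈? as
-- The next hook has arm `a` and nests without padding: the new first row equals the second, and no
-- part size is gained.
... | yes a∈ = begin
  corners (suc (suc a) ∷ map suc (selfConj as ++ replicate (suc a ∸ length (selfConj as)) 0))
    ≡⟨ merged as a>as ds a∈ ⟩
  corners (selfConj as)
    ≡⟨ corners-selfConj ds ⟩
  origin as + (length (starts as) + length (starts as))
    ≡⟨ cong (_+ _) (origin-suc a as) ⟨
  origin (suc a ∷ as) + (length (starts as) + length (starts as)) ∎
  where
  open ≡-Reasoning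
  merged : ∀ as → All (suc a >_) as → Decreasing as → a ∈ as →
    corners (suc (suc a) ∷ map suc (selfConj as ++ replicate (suc a ∸ length (selfConj as)) 0))
      ≡ corners (selfConj as)
  merged (b ∷ as) (a≥b ∷ _) (b>as ∷ _)      (there a∈) = contradiction (All.lookup b>as a∈)
    (ℕ.≤⇒≯ (ℕ.s≤s⁻¹ a≥b))
  merged (b ∷ as) _         ds              (here refl) = begin
    corners (suc (suc b) ∷ map suc
      (selfConj (b ∷ as) ++ replicate (suc b ∸ length (selfConj (b ∷ as))) 0))
      ≡⟨ cong (λ z → corners (suc (suc b) ∷ map suc (selfConj (b ∷ as) ++ replicate z 0)))
           (trans (cong (suc b ∸_) (length-selfConj ds)) (ℕ.n∸n≡0 b)) ⟩
    corners (suc (suc b) ∷ map suc (selfConj (b ∷ as) ++ []))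
      ≡⟨ cong (λ l → corners (suc (suc b) ∷ map suc l)) (List.++-identityʳ (selfConj (b ∷ as))) ⟩
    corners (suc (suc b) ∷ map suc (selfConj (b ∷ as)))
      ≡⟨ corners-repeat (suc (suc b))
        (map suc (map suc (selfConj as ++ replicate (b ∸ length (selfConj as)) 0))) ⟩
    corners (map suc (selfConj (b ∷ as)))
      ≡⟨ corners-map-suc (proj₁ (selfConj-isPartition ds)) ⟩
    corners (selfConj (b ∷ as)) ∎
-- All remaining arms are below `a`. The new first row is strictly longest, and at least one padded
-- zero becomes a row of length 1: two new part sizes.
... | no a∉ = begin
  corners (suc (suc a) ∷ map suc (selfConj as ++ replicate (suc a ∸ length (selfConj as)) 0))
    ≡⟨ cong (λ z → corners (suc (suc a) ∷ map suc (selfConj as ++ replicate z 0)))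
      (ℕ.+-∸-assoc 1 short) ⟩
  corners (suc (suc a) ∷ map suc (selfConj as ++ zs))
    ≡⟨ corners-larger (s≤s (row-map-suc-≤ (selfConj as ++ zs)
      (ℕ.≤-trans (ℕ.≤-reflexive (row-++-zeros (selfConj as) _ 0)) (row-selfConj-< a>'as))))
      (Linked.map⁺ (Linked.map s≤s padded≥)) ⟩
  suc (corners (map suc (selfConj as ++ zs)))
    ≡⟨ cong suc (corners-map-suc padded≥) ⟩
  suc (corners (selfConj as ++ zs))
    ≡⟨ cong suc (corners-++-zeros (proj₁ isP) (proj₂ isP) _) ⟩
  suc (suc (corners (selfConj as)))
    ≡⟨ cong (suc ∘ suc) (corners-selfConj ds) ⟩
  suc (suc (origin as + (length (starts as) + length (starts as))))
    ≡⟨ regroup (origin as) (length (starts as)) ⟩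
  origin as + (suc (length (starts as)) + suc (length (starts as)))
    ≡⟨ cong (_+ _) (origin-suc a as) ⟨
  origin (suc a ∷ as) + (suc (length (starts as)) + suc (length (starts as))) ∎
  where
  open ≡-Reasoning
  regroup : ∀ o l → suc (suc (o + (l + l))) ≡ o + (suc l + suc l)
  regroup = ℕSolver.solve-∀
  a>'as : All (a >_) as
  a>'as = All.tabulate λ b∈ → ℕ.≤∧≢⇒< (ℕ.s≤s⁻¹ (All.lookup a>as b∈)) λ { refl → a∉ b∈ }
  short : length (selfConj as) ≤ a
  short = length-selfConj-≤ (a>'as ∷ ds)
  zs : List ℕ
  zs = replicate (suc (a ∸ length (selfConj as))) 0
  isP : IsPartition (selfConj as)
  isP = selfConj-isPartition ds
  padded≥ : Linked _≥_ (selfConj as ++ zs)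
  padded≥ = Linked-++-zeros (proj₁ isP) _

linear-≤ℤ : ∀ {x y a b} c → x ℤ.≤ y → b ℤ.+ x ≡ a ℤ.+ y ℤ.+ + c → a ℤ.≤ b
linear-≤ℤ {x} {y} {a} {b} c x≤y eq = begin
  a                     ≡⟨ cancel a y ⟩
  a ℤ.+ y - y           ≤⟨ ℤ.+-monoˡ-≤ (- y) (ℤ.i≤i+j (a ℤ.+ y) (+ c)) ⟩
  a ℤ.+ y ℤ.+ + c - y   ≡⟨ cong (_- y) eq ⟨
  b ℤ.+ x - y           ≤⟨ ℤ.+-monoˡ-≤ (- y) (ℤ.+-monoʳ-≤ b x≤y) ⟩
  b ℤ.+ y - y           ≡⟨ cancel b y ⟨
  b                     ∎
  where
  open ℤ.≤-Reasoning
  cancel : ∀ a y → a ≡ a ℤ.+ y - y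
  cancel = ℤSolver.solve-∀

≰⇒1+≤ : ∀ {a b} → ¬ a ℤ.≤ b → 1ℤ ℤ.+ b ℤ.≤ a
≰⇒1+≤ a≰b = ℤ.i<j⇒suc[i]≤j (ℤ.≰⇒> a≰b)

≤⇒∃+ : ∀ {i j} → i ℤ.≤ j → ∃[ n ] j ≡ i ℤ.+ + n
≤⇒∃+ {i} {j} i≤j = ℤ.∣ j - i ∣ , (begin
  j                        ≡⟨ rearrange i j ⟩
  i ℤ.+ (j - i)            ≡⟨ cong (ℤ._+_ i) (ℤ.0≤i⇒+∣i∣≡i (ℤ.i≤j⇒0≤j-i i≤j)) ⟨
  i ℤ.+ + ℤ.∣ j - i ∣      ∎)
  where
  open ≡-Reasoning
  rearrange : ∀ i j → j ≡ i ℤ.+ (j - i)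
  rearrange = ℤSolver.solve-∀

-- Heights on the abacus with s + 1 runners

-- On the runner of n the beads are the positions n + (s + 1) h with h < C n.
-- Elements of as are the beads ≥ 0, and -1 - x is a bead iff x is not in as.
record Profile (s : ℕ) (C : ℕ → ℤ) : Set where
  field
    period : ∀ n → C (n + suc s) ≡ C n - 1ℤ
    mirror : ∀ n n' → n + n' ≡ s → C n ℤ.+ C n' ≡ 0ℤ
    up     : ∀ n → C (suc n) ℤ.≤ C n ℤ.+ 1ℤ
    down   : ∀ n → C n ℤ.≤ C (suc n) ℤ.+ 1ℤ
    skip   : ∀ n → C (suc (suc n)) ℤ.≤ C n ℤ.+ 1ℤ

Represents : (ℕ → ℤ) → List ℕ → Set
Represents C as = ∀ n → n ∈ as ⇔ 1ℤ ℤ.≤ C n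

QuadrupleCoreSet : ℕ → List ℕ → Set
QuadrupleCoreSet s as = CoreSet s as × CoreSet (suc s) as × CoreSet (suc (suc s)) as ×
  CoreSet (suc (suc (suc s))) as

module _ {s C as} (profile : Profile s C) (rep : Represents C as) where
  open Profile profile

  private
    after-period : ∀ {a} n → a ℤ.≤ C (n + suc s) ℤ.+ 1ℤ → a ℤ.≤ C n
    after-period {a} n h = collapse a (C n) (subst (λ c → a ℤ.≤ c ℤ.+ 1ℤ) (period n) h)
      where
      collapse : ∀ a c → a ℤ.≤ c - 1ℤ ℤ.+ 1ℤ → a ℤ.≤ c
      collapse a c h = linear-≤ℤ 0 h (identity a c)
        where
        identity : ∀ a c → c ℤ.+ a ≡ a ℤ.+ (c - 1ℤ ℤ.+ 1ℤ) ℤ.+ + 0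
        identity = ℤSolver.solve-∀

    -- Since `C n'` is `- C n`, a bound on a difference of heights becomes a bound on a sum, as the
    -- first clause of `CoreSet` requires.
    opposite : ∀ {a} n n' → n + n' ≡ s → a ℤ.≤ C n ℤ.+ 1ℤ → a ℤ.+ C n' ℤ.≤ 1ℤ
    opposite {a} n n' eq h = collapse a (C n) (C n') h (ℤ.≤-reflexive (mirror n n' eq))
      where
      collapse : ∀ a c d → a ℤ.≤ c ℤ.+ 1ℤ → c ℤ.+ d ℤ.≤ 0ℤ → a ℤ.+ d ℤ.≤ 1ℤ
      collapse a c d h e = linear-≤ℤ 0 (ℤ.+-mono-≤ h e) (identity a c d)
        where
        identity : ∀ a c d → 1ℤ ℤ.+ (a ℤ.+ (c ℤ.+ d)) ≡ a ℤ.+ d ℤ.+ (c ℤ.+ 1ℤ ℤ.+ 0ℤ) ℤ.+ + 0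
        identity = ℤSolver.solve-∀

    coreSet : ∀ t → (∀ n → C (n + t) ℤ.≤ C n) →
      (∀ n n' → suc (n + n') ≡ t → C n ℤ.+ C n' ℤ.≤ 1ℤ) → CoreSet t as
    coreSet t shift sum =
      (λ n n' n∈ n'∈ eq → contradiction
        (ℤ.≤-trans (ℤ.+-mono-≤ (to (rep n) n∈) (to (rep n') n'∈)) (sum n n' eq))
          λ { (+≤+ (s≤s ())) }) ,
      (λ n n+t∈ → from (rep n) (ℤ.≤-trans (to (rep (n + t)) n+t∈) (shift n)))

    swap : ∀ n n' {b} → C n' ℤ.+ C n ℤ.≤ b → C n ℤ.+ C n' ℤ.≤ b
    swap n n' = subst (ℤ._≤ _) (ℤ.+-comm (C n') (C n))

  profile⇒coreSet : CoreSet s as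
  profile⇒coreSet = coreSet s
    (λ n → after-period n (subst (λ m → C (n + s) ℤ.≤ C m ℤ.+ 1ℤ) (sym (ℕ.+-suc n s))
      (down (n + s))))
    (λ n n' eq → swap n n' (opposite (suc n') n (trans (cong suc (ℕ.+-comm n' n)) eq) (down n')))

  profile⇒coreSet₁ : CoreSet (suc s) as
  profile⇒coreSet₁ = coreSet (suc s)
    (λ n → after-period n (ℤ.i≤i+j _ 1ℤ))
    (λ n n' eq → ℤ.≤-trans (ℤ.≤-reflexive (mirror n n' (ℕ.suc-injective eq))) (+≤+ z≤n))

  profile⇒coreSet₂ : CoreSet (suc (suc s)) as
  profile⇒coreSet₂ = coreSet (suc (suc s))
    (λ n → after-period n (subst (λ m → C m ℤ.≤ C (n + suc s) ℤ.+ 1ℤ) (sym (ℕ.+-suc n (suc s)))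
      (up (n + suc s))))
    sum
    where
    sum : ∀ n n' → suc (n + n') ≡ suc (suc s) → C n ℤ.+ C n' ℤ.≤ 1ℤ
    sum n zero eq = subst (λ m → C m ℤ.+ C 0 ℤ.≤ 1ℤ) (sym n≡)
      (opposite s 0 (ℕ.+-identityʳ s) (up s))
      where
      n≡ : n ≡ suc s
      n≡ = trans (sym (ℕ.+-identityʳ n)) (ℕ.suc-injective eq)
    sum n (suc n') eq = swap n (suc n') (opposite n' n
      (trans (ℕ.+-comm n' n) (ℕ.suc-injective (trans (sym (ℕ.+-suc n n')) (ℕ.suc-injective eq))))
        (up n'))

  profile⇒coreSet₃ : CoreSet (suc (suc (suc s))) as
  profile⇒coreSet₃ = coreSet (suc (suc (suc s)))
    (λ n → after-period n (subst (λ m → C m ℤ.≤ C (n + suc s) ℤ.+ 1ℤ)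
      (sym (trans (ℕ.+-suc n (suc (suc s))) (cong suc (ℕ.+-suc n (suc s))))) (skip (n + suc s))))
    (λ n n' eq → sum n n' (ℕ.suc-injective eq))
    where
    sum : ∀ n n' → n + n' ≡ suc (suc s) → C n ℤ.+ C n' ℤ.≤ 1ℤ
    sum n zero eq = subst (λ m → C m ℤ.+ C 0 ℤ.≤ 1ℤ) (trans (sym eq) (ℕ.+-identityʳ n))
      (opposite s 0 (ℕ.+-identityʳ s) (skip s))
    -- Here `n` is `s + 1`, beyond the mirrored range. Moving both indices by a period turns
    -- `C (s + 1) + C 1` into `C 0 + C (s + 2)`, which `skip` at `s` bounds.
    sum n (suc zero) eq = subst (λ m → C m ℤ.+ C 1 ℤ.≤ 1ℤ) (sym n≡)
      (collapse (C (suc s)) (C 0) (C 1) (C (suc (suc s))) (ℤ.≤-reflexive (period 0))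
        (ℤ.≤-reflexive (sym (period 1)))
        (opposite s 0 (ℕ.+-identityʳ s) (skip s)))
      where
      n≡ : n ≡ suc s
      n≡ = ℕ.suc-injective (trans (ℕ.+-comm 1 n) eq)
      collapse : ∀ a b c d → a ℤ.≤ b - 1ℤ → c - 1ℤ ℤ.≤ d → d ℤ.+ b ℤ.≤ 1ℤ → a ℤ.+ c ℤ.≤ 1ℤ
      collapse a b c d h₁ h₂ h₃ = linear-≤ℤ 0 (ℤ.+-mono-≤ (ℤ.+-mono-≤ h₁ h₂) h₃) (identity a b c d)
        where
        identity : ∀ a b c d → 1ℤ ℤ.+ (a ℤ.+ (c - 1ℤ) ℤ.+ (d ℤ.+ b)) ≡ a ℤ.+ c
          ℤ.+ (b - 1ℤ ℤ.+ d ℤ.+ 1ℤ) ℤ.+ + 0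
        identity = ℤSolver.solve-∀
    sum n (suc (suc n')) eq = swap n (suc (suc n')) (opposite n' n
      (trans (ℕ.+-comm n' n) (ℕ.+-cancelʳ-≡ 2 _ _ (trans (ℕ.+-assoc n n' 2)
        (trans (cong (_+_ n) (ℕ.+-comm n' 2)) (trans eq (ℕ.+-comm 2 s)))))) (skip n'))

  profile⇒quadrupleCoreSet : QuadrupleCoreSet s as
  profile⇒quadrupleCoreSet = profile⇒coreSet , profile⇒coreSet₁ , profile⇒coreSet₂ ,
    profile⇒coreSet₃

-- From sets closed under subtraction to heights

threshold : (P : ℤ → Set) → (∀ h → Dec (P h)) → (∀ h → P (h ℤ.+ 1ℤ) → P h) →
  ∀ ℓ h₀ → P h₀ → ¬ P (h₀ ℤ.+ + ℓ) → ∃[ c ] ∀ h → P h ⇔ 1ℤ ℤ.+ h ℤ.≤ c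
threshold P P? closed = search
  where
  lower : ∀ n h → P (h ℤ.+ + n) → P h
  lower zero    h p = subst P (ℤ.+-identityʳ h) p
  lower (suc n) h p = lower n h (closed (h ℤ.+ + n) (subst P (regroup h (+ n)) p))
    where
    regroup : ∀ h m → h ℤ.+ (1ℤ ℤ.+ m) ≡ h ℤ.+ m ℤ.+ 1ℤ
    regroup = ℤSolver.solve-∀
  lower-≤ : ∀ {h k} → h ℤ.≤ k → P k → P h
  lower-≤ h≤k p with ≤⇒∃+ h≤k
  ... | n , refl = lower n _ p
  search : ∀ ℓ h₀ → P h₀ → ¬ P (h₀ ℤ.+ + ℓ) → ∃[ c ] ∀ h → P h ⇔ 1ℤ ℤ.+ h ℤ.≤ c
  search zero    h₀ p ¬p = contradiction (subst P (sym (ℤ.+-identityʳ h₀)) p) ¬p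
  search (suc ℓ) h₀ p ¬p with P? (h₀ ℤ.+ 1ℤ)
  ... | yes p' = search ℓ (h₀ ℤ.+ 1ℤ) p' (¬p ∘ subst P (regroup h₀ (+ ℓ)))
    where
    regroup : ∀ h m → h ℤ.+ 1ℤ ℤ.+ m ≡ h ℤ.+ (1ℤ ℤ.+ m)
    regroup = ℤSolver.solve-∀
  -- By downward closure `h₀` is the last height satisfying `P`; the threshold is strict, hence the
  -- successor.
  ... | no ¬p' = h₀ ℤ.+ 1ℤ , λ h → mk⇔ (λ ph → upper h ph) (λ h≤ → lower-≤ (cancel h h₀ h≤) p)
    where
    cancel : ∀ h h₀ → 1ℤ ℤ.+ h ℤ.≤ h₀ ℤ.+ 1ℤ → h ℤ.≤ h₀
    cancel h h₀ le = linear-≤ℤ 0 le (identity h h₀)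
      where
      identity : ∀ h h₀ → h₀ ℤ.+ (1ℤ ℤ.+ h) ≡ h ℤ.+ (h₀ ℤ.+ 1ℤ) ℤ.+ + 0
      identity = ℤSolver.solve-∀
    above : ∀ h h₀ → 1ℤ ℤ.+ (h₀ ℤ.+ 1ℤ) ℤ.≤ 1ℤ ℤ.+ h → h₀ ℤ.+ 1ℤ ℤ.≤ h
    above h h₀ le = linear-≤ℤ 0 le (identity h h₀)
      where
      identity : ∀ h h₀ → h ℤ.+ (1ℤ ℤ.+ (h₀ ℤ.+ 1ℤ)) ≡ h₀ ℤ.+ 1ℤ ℤ.+ (1ℤ ℤ.+ h) ℤ.+ + 0
      identity = ℤSolver.solve-∀
    upper : ∀ h → P h → 1ℤ ℤ.+ h ℤ.≤ h₀ ℤ.+ 1ℤ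
    upper h ph with (1ℤ ℤ.+ h) ℤ.≤? (h₀ ℤ.+ 1ℤ)
    ... | yes le = le
    ... | no ¬le = contradiction (lower-≤ (above h h₀ (≰⇒1+≤ ¬le)) ph) ¬p'

-- `-[1+ n ]` is the position `-1 - n`, so the antisymmetric bead set follows the constructors of
-- `ℤ`.
Bead : List ℕ → ℤ → Set
Bead as (+ n)    = n ∈ as
Bead as -[1+ n ] = n ∉ as

bead? : ∀ as b → Dec (Bead as b)
bead? as (+ n)    = n ∈? as
bead? as -[1+ n ] = ¬? (n ∈? as)

bead-mirror : ∀ as b → Bead as (- 1ℤ - b) ⇔ (¬ Bead as b)
bead-mirror as (+ zero)  = mk⇔ id id
bead-mirror as (+ suc n) = mk⇔ id id
bead-mirror as -[1+ n ]  = mk⇔ (λ n∈ n∉ → n∉ n∈) (decidable-stable (n ∈? as))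

bead-shift : ∀ {as t} → CoreSet t as → ∀ b → Bead as (b ℤ.+ + t) → Bead as b
bead-shift (_ , shifts) (+ n) = shifts n
bead-shift {as} {t} (sums , shifts) -[1+ n ] bead n∈ with t ≤? n
... | yes t≤n = subst (Bead as) (trans (ℤ.⊖-< (s≤s t≤n)) (cong (λ m → - + m) (ℕ.+-∸-assoc 1 t≤n)))
  bead
                  (shifts (n ∸ t) (subst (_∈ as) (sym (ℕ.m∸n+n≡m t≤n)) n∈))
... | no t≰n  = sums (t ∸ suc n) n (subst (Bead as) (ℤ.⊖-≥ (ℕ.≰⇒> t≰n)) bead) n∈
                  (trans (sym (ℕ.+-suc (t ∸ suc n) n)) (ℕ.m∸n+n≡m (ℕ.≰⇒> t≰n)))

bead-below : ∀ {as N b} → (∀ {n} → n ∈ as → n < N) → b ℤ.≤ -[1+ N ] → Bead as b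
bead-below bounded (ℤ.-≤- N≤n) n∈ = ℕ.<⇒≱ (bounded n∈) N≤n

no-bead-above : ∀ {as N b} → (∀ {n} → n ∈ as → n < N) → + N ℤ.≤ b → ¬ Bead as b
no-bead-above bounded (+≤+ N≤n) n∈ = ℕ.<⇒≱ (bounded n∈) N≤n

Decreasing-bounded : ∀ {as} → Decreasing as → ∃[ N ] ∀ {n} → n ∈ as → n < N
Decreasing-bounded []                      = 0 , λ ()
Decreasing-bounded {a ∷ _} (a>as ∷ _)      = suc a , λ
  { (here refl) → ℕ.≤-refl ; (there n∈) → ℕ.m≤n⇒m≤1+n (All.lookup a>as n∈) }

module _ {s as} (d : Decreasing as) (core : QuadrupleCoreSet s as) where

  private
    T : ℤ
    T = 1ℤ ℤ.+ + s

    N : ℕ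
    N = proj₁ (Decreasing-bounded d)

    RunnerHeight : ℤ → ℤ → Set
    RunnerHeight b c = ∀ h → Bead as (b ℤ.+ T * h) ⇔ 1ℤ ℤ.+ h ℤ.≤ c

    runner : ∀ n → ∃ (RunnerHeight (+ n))
    runner n = threshold (λ h → Bead as (+ n ℤ.+ T * h)) (λ h → bead? as (+ n ℤ.+ T * h)) closed
      -- Every position up to `-1 - N` is a bead and none from `N` on. The search starts at height
      -- `-(1 + n + N)`, and its length is chosen to end at height `N`.
      (suc (n + N) + N) (- + suc (n + N))
      (bead-below (proj₂ (Decreasing-bounded d)) low)
      (no-bead-above (proj₂ (Decreasing-bounded d)) (subst (λ h → + N ℤ.≤ + n ℤ.+ T * h)
        (sym (top (+ suc (n + N)) (+ N))) high))
      where
      closed : ∀ h → Bead as (+ n ℤ.+ T * (h ℤ.+ 1ℤ)) → Bead as (+ n ℤ.+ T * h)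
      closed h bead = bead-shift (proj₁ (proj₂ core)) _ (subst (Bead as) (identity (+ n) T h) bead)
        where
        identity : ∀ n t h → n ℤ.+ t * (h ℤ.+ 1ℤ) ≡ n ℤ.+ t * h ℤ.+ t
        identity = ℤSolver.solve-∀
      top : ∀ m k → - m ℤ.+ (m ℤ.+ k) ≡ k
      top = ℤSolver.solve-∀
      0≤sx : ∀ x → 0ℤ ℤ.≤ + s * + x
      0≤sx x = subst (0ℤ ℤ.≤_) (ℤ.pos-* s x) (+≤+ z≤n)
      low : + n ℤ.+ T * (- + suc (n + N)) ℤ.≤ -[1+ N ]
      low = linear-≤ℤ 0 (0≤sx (suc (n + N))) (identity (+ n) (+ N) (+ s))
        where
        identity : ∀ n N s → - (1ℤ ℤ.+ N) ℤ.+ 0ℤ ≡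
          n ℤ.+ (1ℤ ℤ.+ s) * (- (1ℤ ℤ.+ (n ℤ.+ N))) ℤ.+ s * (1ℤ ℤ.+ (n ℤ.+ N)) ℤ.+ + 0
        identity = ℤSolver.solve-∀
      high : + N ℤ.≤ + n ℤ.+ T * + N
      high = linear-≤ℤ n (0≤sx N) (identity (+ n) (+ N) (+ s))
        where
        identity : ∀ n N s → n ℤ.+ (1ℤ ℤ.+ s) * N ℤ.+ 0ℤ ≡ N ℤ.+ s * N ℤ.+ n
        identity = ℤSolver.solve-∀

    C : ℕ → ℤ
    C n = proj₁ (runner n)

    -- Subtracting `t` from the top bead of runner `n`, at height `C n - 1`, lands on runner `n'` at
    -- height `C n - 1 - j`, which must therefore lie below `C n'`. All inequalities between heights
    -- are instances.
    compare : ∀ n n' t j → (∀ x → Bead as (x ℤ.+ t) → Bead as x) → + n' ℤ.+ t ≡ + n ℤ.+ T * j →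
      C n ℤ.≤ C n' ℤ.+ j
    compare n n' t j shift eq = conclude c c' j
      (to (proj₂ (runner n') (c - 1ℤ - j))
        (shift _ (subst (Bead as) moved
        (from (proj₂ (runner n) (c - 1ℤ)) (ℤ.≤-reflexive (one c))))))
      where
      b b' c c' : ℤ
      b  = + n
      b' = + n'
      c  = C n
      c' = C n'
      one : ∀ c → 1ℤ ℤ.+ (c - 1ℤ) ≡ c
      one = ℤSolver.solve-∀
      moved : b ℤ.+ T * (c - 1ℤ) ≡ b' ℤ.+ T * (c - 1ℤ - j) ℤ.+ t
      moved = begin
        b ℤ.+ T * (c - 1ℤ)                              ≡⟨ split b T c j ⟩
        b ℤ.+ T * j ℤ.+ T * (c - 1ℤ - j)                ≡⟨ cong (ℤ._+ T * (c - 1ℤ - j)) eq ⟨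
        b' ℤ.+ t ℤ.+ T * (c - 1ℤ - j)                   ≡⟨ reorder b' t (T * (c - 1ℤ - j)) ⟩
        b' ℤ.+ T * (c - 1ℤ - j) ℤ.+ t                   ∎
        where
        open ≡-Reasoning
        split : ∀ b T c j → b ℤ.+ T * (c - 1ℤ) ≡ b ℤ.+ T * j ℤ.+ T * (c - 1ℤ - j)
        split = ℤSolver.solve-∀
        reorder : ∀ b t x → b ℤ.+ t ℤ.+ x ≡ b ℤ.+ x ℤ.+ t
        reorder = ℤSolver.solve-∀
      conclude : ∀ c c' j → 1ℤ ℤ.+ (c - 1ℤ - j) ℤ.≤ c' → c ℤ.≤ c' ℤ.+ j
      conclude c c' j h = linear-≤ℤ 0 h (identity c c' j)
        where
        identity : ∀ c c' j → c' ℤ.+ j ℤ.+ (1ℤ ℤ.+ (c - 1ℤ - j)) ≡ c ℤ.+ c' ℤ.+ + 0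
        identity = ℤSolver.solve-∀

    stay : ∀ x → Bead as (x ℤ.+ 0ℤ) → Bead as x
    stay x = subst (Bead as) (ℤ.+-identityʳ x)

    C-period : ∀ n → C (n + suc s) ≡ C n - 1ℤ
    C-period n = ℤ.≤-antisym
      -- Indices `n` and `n + suc s` name the same runner with its origin displaced by one height,
      -- so the shift 0 is compared in both directions.
      (compare (n + suc s) n 0ℤ (- 1ℤ) stay (identity₁ (+ n) T))
      (transpose (C n) (C (n + suc s)) (compare n (n + suc s) 0ℤ 1ℤ stay (identity₂ (+ n) T)))
      where
      identity₁ : ∀ n t → n ℤ.+ 0ℤ ≡ n ℤ.+ t ℤ.+ t * (- 1ℤ)
      identity₁ = ℤSolver.solve-∀
      identity₂ : ∀ n t → n ℤ.+ t ℤ.+ 0ℤ ≡ n ℤ.+ t * 1ℤ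
      identity₂ = ℤSolver.solve-∀
      transpose : ∀ a b → a ℤ.≤ b ℤ.+ 1ℤ → a - 1ℤ ℤ.≤ b
      transpose a b h = linear-≤ℤ 0 h (identity a b)
        where
        identity : ∀ a b → b ℤ.+ a ≡ a - 1ℤ ℤ.+ (b ℤ.+ 1ℤ) ℤ.+ + 0
        identity = ℤSolver.solve-∀

    C-up : ∀ n → C (suc n) ℤ.≤ C n ℤ.+ 1ℤ
    C-up n = compare (suc n) n (+ suc (suc s)) 1ℤ (bead-shift (proj₁ (proj₂ (proj₂ core))))
      (identity (+ n) (+ s))
      where
      identity : ∀ n s → n ℤ.+ (1ℤ ℤ.+ (1ℤ ℤ.+ s)) ≡ 1ℤ ℤ.+ n ℤ.+ (1ℤ ℤ.+ s) * 1ℤ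
      identity = ℤSolver.solve-∀

    C-down : ∀ n → C n ℤ.≤ C (suc n) ℤ.+ 1ℤ
    C-down n = compare n (suc n) (+ s) 1ℤ (bead-shift (proj₁ core)) (identity (+ n) (+ s))
      where
      identity : ∀ n s → 1ℤ ℤ.+ n ℤ.+ s ≡ n ℤ.+ (1ℤ ℤ.+ s) * 1ℤ
      identity = ℤSolver.solve-∀

    C-skip : ∀ n → C (suc (suc n)) ℤ.≤ C n ℤ.+ 1ℤ
    C-skip n = compare (suc (suc n)) n (+ suc (suc (suc s))) 1ℤ
      (bead-shift (proj₂ (proj₂ (proj₂ core)))) (identity (+ n) (+ s))
      where
      identity : ∀ n s → n ℤ.+ (1ℤ ℤ.+ (1ℤ ℤ.+ (1ℤ ℤ.+ s))) ≡ 1ℤ ℤ.+ (1ℤ ℤ.+ n) ℤ.+ (1ℤ ℤ.+ s) * 1ℤ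
      identity = ℤSolver.solve-∀

    -- The reflection `b ↦ -1 - b` exchanges the runners `n` and `n'` and sends height `h` to
    -- `-1 - h`, while it swaps beads and gaps.
    C-mirror : ∀ n n' → n + n' ≡ s → C n ℤ.+ C n' ≡ 0ℤ
    C-mirror n n' eq = ℤ.≤-antisym
      (upper (C n) (C n') (≰⇒1+≤ (to (reflected (C n' - 1ℤ)) (ℤ.≤-reflexive (one (C n'))))))
      (lower (C n) (C n') (decidable-stable (_ ℤ.≤? C n)
        (λ ¬le → irrefl (C n') (from (reflected (C n')) ¬le))))
      where
      one : ∀ c → 1ℤ ℤ.+ (c - 1ℤ) ≡ c
      one = ℤSolver.solve-∀
      irrefl : ∀ c → ¬ 1ℤ ℤ.+ c ℤ.≤ c
      irrefl c h = ℤ.<-irrefl refl (ℤ.suc[i]≤j⇒i<j h)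
      place : ∀ h → + n' ℤ.+ T * h ≡ - 1ℤ - (+ n ℤ.+ T * (- 1ℤ - h))
      place h = subst (λ m → + n' ℤ.+ (1ℤ ℤ.+ + m) * h ≡ - 1ℤ - (+ n ℤ.+ (1ℤ ℤ.+ + m) * (- 1ℤ - h)))
        eq
        (identity (+ n) (+ n') h)
        where
        identity : ∀ n n' h → n' ℤ.+ (1ℤ ℤ.+ (n ℤ.+ n')) * h ≡ - 1ℤ
          - (n ℤ.+ (1ℤ ℤ.+ (n ℤ.+ n')) * (- 1ℤ - h))
        identity = ℤSolver.solve-∀
      reflected : ∀ h → 1ℤ ℤ.+ h ℤ.≤ C n' ⇔ (¬ 1ℤ ℤ.+ (- 1ℤ - h) ℤ.≤ C n)
      reflected h = mk⇔
        (λ h< le → to (bead-mirror as _) (subst (Bead as) (place h) (from (proj₂ (runner n') h) h<))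
          (from (proj₂ (runner n) (- 1ℤ - h)) le))
        (λ ¬le → to (proj₂ (runner n') h)
          (subst (Bead as) (sym (place h))
          (from (bead-mirror as _) (¬le ∘ to (proj₂ (runner n) (- 1ℤ - h))))))
      upper : ∀ c c' → 1ℤ ℤ.+ c ℤ.≤ 1ℤ ℤ.+ (- 1ℤ - (c' - 1ℤ)) → c ℤ.+ c' ℤ.≤ 0ℤ
      upper c c' h = linear-≤ℤ 0 h (identity c c')
        where
        identity : ∀ c c' → 0ℤ ℤ.+ (1ℤ ℤ.+ c) ≡ c ℤ.+ c' ℤ.+ (1ℤ ℤ.+ (- 1ℤ - (c' - 1ℤ))) ℤ.+ + 0
        identity = ℤSolver.solve-∀
      lower : ∀ c c' → 1ℤ ℤ.+ (- 1ℤ - c') ℤ.≤ c → 0ℤ ℤ.≤ c ℤ.+ c'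
      lower c c' h = linear-≤ℤ 0 h (identity c c')
        where
        identity : ∀ c c' → c ℤ.+ c' ℤ.+ (1ℤ ℤ.+ (- 1ℤ - c')) ≡ 0ℤ ℤ.+ c ℤ.+ + 0
        identity = ℤSolver.solve-∀

  coreSet⇒profile : ∃[ C ] Profile s C × Represents C as
  coreSet⇒profile = C , record { period = C-period ; mirror = C-mirror ; up = C-up ; down =
    C-down ; skip = C-skip } ,
    λ n → subst (λ b → Bead as b ⇔ 1ℤ ℤ.≤ C n) (origin-of (+ n) T) (proj₂ (runner n) 0ℤ)
    where
    origin-of : ∀ n t → n ℤ.+ t * 0ℤ ≡ n
    origin-of = ℤSolver.solve-∀

-- The differences 1, 0 and -1 between the heights of neighbouring runners.
data Letter : Set where
  U F D : Letter

Word : Set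
Word = List Letter

-- Words of height differences over half a period

-- Heights are normalised to vanish at the end of the word.
height : Word → ℤ
height []      = 0ℤ
height (U ∷ w) = height w - 1ℤ
height (F ∷ w) = height w
height (D ∷ w) = height w ℤ.+ 1ℤ

-- Here e is the parity of s.  For even s the last letter is followed by its own
-- mirror image, so a final U would be doubled.
data Free (e : ℕ) : Word → Set
data Plain (e : ℕ) : Word → Set

data Free e where
  empty : Free e []
  plain : ∀ {w} → Plain e w → Free e w
  last  : e ≡ 1 → Free e (U ∷ [])
  climb : ∀ {w} → Plain e w → Free e (U ∷ w)

data Plain e where
  flat : ∀ {w} → Free e w → Plain e (F ∷ w)
  fall : ∀ {w} → Free e w → Plain e (D ∷ w)

Free-tail : ∀ {e x w} → Free e (x ∷ w) → Free e w
Free-tail (plain (flat f)) = f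
Free-tail (plain (fall f)) = f
Free-tail (last _)         = empty
Free-tail (climb p)        = plain p

0≤1 : 0ℤ ℤ.≤ 1ℤ
0≤1 = +≤+ z≤n

b-1+1≡b : ∀ b → b - 1ℤ ℤ.+ 1ℤ ≡ b
b-1+1≡b = ℤSolver.solve-∀

height-up : ∀ w v → height (drop (suc v) w) ℤ.≤ height (drop v w) ℤ.+ 1ℤ
height-up []      zero    = 0≤1
height-up []      (suc v) = 0≤1
height-up (U ∷ w) zero    = ℤ.≤-reflexive (sym (b-1+1≡b (height w)))
height-up (F ∷ w) zero    = ℤ.i≤i+j (height w) 1ℤ
height-up (D ∷ w) zero    = ℤ.≤-trans (ℤ.i≤i+j (height w) 1ℤ) (ℤ.i≤i+j _ 1ℤ)
height-up (_ ∷ w) (suc v) = height-up w v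

height-down : ∀ w v → height (drop v w) ℤ.≤ height (drop (suc v) w) ℤ.+ 1ℤ
height-down []      zero    = 0≤1
height-down []      (suc v) = 0≤1
height-down (U ∷ w) zero    = ℤ.≤-trans (ℤ.i-j≤i (height w) 1ℤ) (ℤ.i≤i+j (height w) 1ℤ)
height-down (F ∷ w) zero    = ℤ.i≤i+j (height w) 1ℤ
height-down (D ∷ w) zero    = ℤ.≤-refl
height-down (_ ∷ w) (suc v) = height-down w v

-- Only two adjacent letters `U` could break the bound, and `Free` has no constructor that produces
-- them.
height-skip : ∀ {e w} → Free e w → ∀ v → height (drop (suc (suc v)) w) ℤ.≤ height (drop v w) ℤ.+ 1ℤ
height-skip {w = []}         _ zero    = 0≤1
height-skip {w = []}         _ (suc v) = 0≤1
height-skip {w = x ∷ []}     f zero    = height-up (x ∷ []) 0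
height-skip {w = U ∷ F ∷ w}  f zero    = height-up (U ∷ w) 0
height-skip {w = U ∷ D ∷ w}  f zero    = ℤ.≤-trans (height-up (F ∷ w) 0)
  (ℤ.≤-reflexive (identity (height w)))
  where
  identity : ∀ h → h ℤ.+ 1ℤ ≡ h ℤ.+ 1ℤ - 1ℤ ℤ.+ 1ℤ
  identity = ℤSolver.solve-∀
height-skip {w = U ∷ U ∷ w}  (plain ()) zero
height-skip {w = U ∷ U ∷ w}  (climb ()) zero
height-skip {w = F ∷ y ∷ w}  f zero    = height-up (y ∷ w) 0
height-skip {w = D ∷ y ∷ w}  f zero    = ℤ.≤-trans (height-up (y ∷ w) 0) (ℤ.i≤i+j _ 1ℤ)
height-skip {w = _ ∷ w}      f (suc v) = height-skip (Free-tail f) v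

-- For even `s` the last letter is not `U`; this is what the window across the middle needs.
height-last : ∀ {w} → Free 0 w → ∀ v → length w ≡ suc v → 0ℤ ℤ.≤ height (drop v w)
height-last {F ∷ []}    _         zero    _    = +≤+ z≤n
height-last {D ∷ []}    _         zero    _    = +≤+ z≤n
height-last {U ∷ []}    (plain ())  zero    _
height-last {U ∷ []}    (last ())   zero    _
height-last {U ∷ []}    (climb ())  zero    _
height-last {_ ∷ w}     f         (suc v) eq   = height-last (Free-tail f) v (ℕ.suc-injective eq)

height-bound : ∀ w → height w ℤ.≤ + length w × - + length w ℤ.≤ height w
height-bound []      = ℤ.≤-refl , ℤ.≤-refl
height-bound (x ∷ w) with height-bound w
... | hi , lo = bounds x
  where
  l : ℤ
  l = + length w
  identity₁ : ∀ h l → 1ℤ ℤ.+ l ℤ.+ h ≡ h - 1ℤ ℤ.+ l ℤ.+ + 2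
  identity₁ = ℤSolver.solve-∀
  identity₂ : ∀ h l → h - 1ℤ ℤ.+ - l ≡ - (1ℤ ℤ.+ l) ℤ.+ h ℤ.+ + 0
  identity₂ = ℤSolver.solve-∀
  identity₃ : ∀ h l → 1ℤ ℤ.+ l ℤ.+ h ≡ h ℤ.+ l ℤ.+ + 1
  identity₃ = ℤSolver.solve-∀
  identity₄ : ∀ h l → h ℤ.+ - l ≡ - (1ℤ ℤ.+ l) ℤ.+ h ℤ.+ + 1
  identity₄ = ℤSolver.solve-∀
  identity₅ : ∀ h l → 1ℤ ℤ.+ l ℤ.+ h ≡ h ℤ.+ 1ℤ ℤ.+ l ℤ.+ + 0
  identity₅ = ℤSolver.solve-∀
  identity₆ : ∀ h l → h ℤ.+ 1ℤ ℤ.+ - l ≡ - (1ℤ ℤ.+ l) ℤ.+ h ℤ.+ + 2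
  identity₆ = ℤSolver.solve-∀
  bounds : ∀ x → height (x ∷ w) ℤ.≤ 1ℤ ℤ.+ l × - (1ℤ ℤ.+ l) ℤ.≤ height (x ∷ w)
  bounds U = linear-≤ℤ 2 hi (identity₁ (height w) l) , linear-≤ℤ 0 lo (identity₂ (height w) l)
  bounds F = linear-≤ℤ 1 hi (identity₃ (height w) l) , linear-≤ℤ 1 lo (identity₄ (height w) l)
  bounds D = linear-≤ℤ 0 hi (identity₅ (height w) l) , linear-≤ℤ 2 lo (identity₆ (height w) l)

-- The last index is 1 iff 0 ∈ as; the first letter then follows the U at 0.
data Admissible (e : ℕ) (w : Word) : ℕ → Set where
  outside : Free e w → height w ≡ 0ℤ → Admissible e w 0
  inside  : Plain e w → height w ≡ 1ℤ → Admissible e w 1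

Admissible⇒Free : ∀ {e w c} → Admissible e w c → Free e w
Admissible⇒Free (outside f _) = f
Admissible⇒Free (inside p _)  = plain p

Admissible-height : ∀ {e w c} → Admissible e w c → height w ≡ + c
Admissible-height (outside _ h) = h
Admissible-height (inside _ h)  = h

-- The profile of a word

-- For a word of length ⌊ s /2⌋ and v ≤ s at most one of the two heights is
-- nonzero: past the middle the word is continued by its mirror image.
wordHeight : ℕ → Word → ℕ → ℤ
wordHeight s w v = height (drop v w) - height (drop (s ∸ v) w)

wordProfile : ℕ → Word → ℕ → ℤ
wordProfile s w n = wordHeight s w (n % suc s) - + (n / suc s)

wordProfile-at : ∀ s w {v} → v ≤ s → ∀ q →
  wordProfile s w (v + q ℕ.* suc s) ≡ wordHeight s w v - + q
wordProfile-at s w {v} v≤s q = cong₂ (λ x y → wordHeight s w x - + y) remainder quotient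
  where
  remainder : (v + q ℕ.* suc s) % suc s ≡ v
  remainder = trans ([m+kn]%n≡m%n v q (suc s)) (m≤n⇒m%n≡m v≤s)
  quotient : (v + q ℕ.* suc s) / suc s ≡ q
  quotient = trans (+-distrib-/-∣ʳ v (n∣m*n q))
    (cong₂ _+_ (m<n⇒m/n≡0 (s≤s v≤s)) (m*n/n≡m q (suc s)))

wordHeight-mirror : ∀ s w {v v'} → v + v' ≡ s → wordHeight s w v ℤ.+ wordHeight s w v' ≡ 0ℤ
wordHeight-mirror s w {v} {v'} refl =
  trans (cong₂ (λ x y → height (drop v w) - height (drop x w)
                         ℤ.+ (height (drop v' w) - height (drop y w)))
          (ℕ.m+n∸m≡n v v') (ℕ.m+n∸n≡m v v'))
        (identity (height (drop v w)) (height (drop v' w)))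
  where
  identity : ∀ a b → a - b ℤ.+ (b - a) ≡ 0ℤ
  identity = ℤSolver.solve-∀

height-beyond : ∀ {v} w → length w ≤ v → height (drop v w) ≡ 0ℤ
height-beyond {v} w le = cong height (List.drop-all v w le)

-- The residue comes with its complement `v'` to `s`: matching on `v'` shows how close `v` is to the
-- end of the period, where the next index wraps around.
periodically : ∀ s (Q : ℕ → Set) → (∀ v v' q → v + v' ≡ s → Q (v + q ℕ.* suc s)) → ∀ n → Q n
periodically s Q h n = subst Q (sym (m≡m%n+[m/n]*n n (suc s)))
  (h (n % suc s) (s ∸ n % suc s) (n / suc s) (ℕ.m+[n∸m]≡n (ℕ.s≤s⁻¹ (m%n<n n (suc s)))))

wordHeight-split : ∀ s w v v' → v + v' ≡ s →
  wordHeight s w v ≡ height (drop v w) - height (drop v' w)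
wordHeight-split s w v v' eq = cong (λ x → height (drop v w) - height (drop x w))
  (trans (cong (_∸ v) (sym eq)) (ℕ.m+n∸m≡n v v'))

-- The mirror image of an index in the left half lies where the height of the word has already
-- vanished.
far : ∀ {k e v v'} → v + v' ≡ k + (k + e) → v ≤ k → k ≤ v'
far {k} {e} {v} {v'} eq v≤k = linear-≤ e v≤k (trans (ℕ.+-comm v' v) (trans eq (identity k e)))
  where
  identity : ∀ k e → k + (k + e) ≡ k + k + e
  identity = ℕSolver.solve-∀

module _ {k e c w} (nonzero : 1 ≤ k + e) (len : length w ≡ k) (adm : Admissible e w c) where

  private
    s : ℕ
    s = k + (k + e)

    S B : ℕ → ℤ
    S v = height (drop v w)
    B = wordHeight s w

    S-beyond : ∀ {v} → k ≤ v → S v ≡ 0ℤ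
    S-beyond k≤v = height-beyond w (subst (_≤ _) (sym len) k≤v)

    B-split : ∀ v v' → v + v' ≡ s → B v ≡ S v - S v'
    B-split = wordHeight-split s w

    sub-mono : ∀ {a b c d} → a ℤ.≤ b ℤ.+ 1ℤ → c ≡ 0ℤ → d ≡ 0ℤ → a - c ℤ.≤ b - d ℤ.+ 1ℤ
    sub-mono {a} {b} h refl refl = subst₂ ℤ._≤_ (identity₁ a) (identity₂ b) h
      where
      identity₁ : ∀ a → a ≡ a - 0ℤ
      identity₁ = ℤSolver.solve-∀
      identity₂ : ∀ b → b ℤ.+ 1ℤ ≡ b - 0ℤ ℤ.+ 1ℤ
      identity₂ = ℤSolver.solve-∀

    sub-anti : ∀ {a b c d} → a ≡ 0ℤ → b ≡ 0ℤ → d ℤ.≤ c ℤ.+ 1ℤ → a - c ℤ.≤ b - d ℤ.+ 1ℤ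
    sub-anti {c = c} {d} refl refl h = linear-≤ℤ 0 h (identity c d)
      where
      identity : ∀ c d → 0ℤ - d ℤ.+ 1ℤ ℤ.+ d ≡ 0ℤ - c ℤ.+ (c ℤ.+ 1ℤ) ℤ.+ + 0
      identity = ℤSolver.solve-∀

    -- On either side of the middle one of the two terms of `B` vanishes, so the step is a step of
    -- the word itself or of its mirror image.
    B-up : ∀ v v' → suc v + v' ≡ s → B (suc v) ℤ.≤ B v ℤ.+ 1ℤ
    B-up v v' eq = subst₂ (λ a b → a ℤ.≤ b ℤ.+ 1ℤ) (sym (B-split (suc v) v' eq))
      (sym (B-split v (suc v') (trans (ℕ.+-suc v v') eq)))
      (case v <? k of λ
        { (yes v<k) → sub-mono {b = S v} (height-up w v) (S-beyond (far {k} {e} eq v<k))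
                        (S-beyond (ℕ.m≤n⇒m≤1+n (far {k} {e} eq v<k)))
        ; (no v≮k)  → sub-anti (S-beyond (ℕ.m≤n⇒m≤1+n (ℕ.≮⇒≥ v≮k))) (S-beyond (ℕ.≮⇒≥ v≮k))
            (height-up w v') })

    B-down : ∀ v v' → suc v + v' ≡ s → B v ℤ.≤ B (suc v) ℤ.+ 1ℤ
    B-down v v' eq = subst₂ (λ a b → a ℤ.≤ b ℤ.+ 1ℤ)
      (sym (B-split v (suc v') (trans (ℕ.+-suc v v') eq))) (sym (B-split (suc v) v' eq))
      (case v <? k of λ
        { (yes v<k) → sub-mono {b = S (suc v)} (height-down w v)
            (S-beyond (ℕ.m≤n⇒m≤1+n (far {k} {e} eq v<k))) (S-beyond (far {k} {e} eq v<k))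
        ; (no v≮k)  → sub-anti (S-beyond (ℕ.≮⇒≥ v≮k)) (S-beyond (ℕ.m≤n⇒m≤1+n (ℕ.≮⇒≥ v≮k)))
            (height-down w v') })

    -- The only window not controlled by one half of the word is the middle
    -- one; it exists only for e ≡ 0.
    B-skip : ∀ v v' → suc (suc v) + v' ≡ s → B (suc (suc v)) ℤ.≤ B v ℤ.+ 1ℤ
    B-skip v v' eq = subst₂ (λ a b → a ℤ.≤ b ℤ.+ 1ℤ) (sym (B-split (suc (suc v)) v' eq))
      (sym (B-split v (suc (suc v')) (trans (trans (ℕ.+-suc v (suc v')) (cong suc (ℕ.+-suc v v')))
        eq)))
      (case v <? k of λ
        { (no v≮k)  → sub-anti (S-beyond (ℕ.m≤n⇒m≤1+n (ℕ.m≤n⇒m≤1+n (ℕ.≮⇒≥ v≮k))))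
            (S-beyond (ℕ.≮⇒≥ v≮k)) (height-skip free v')
        ; (yes v<k) → case v' <? k of λ
          { (no v'≮k)  → sub-mono {b = S v} (height-skip free v) (S-beyond (ℕ.≮⇒≥ v'≮k))
              (S-beyond (ℕ.m≤n⇒m≤1+n (ℕ.m≤n⇒m≤1+n (ℕ.≮⇒≥ v'≮k))))
          ; (yes v'<k) → middle v<k v'<k } })
      where
      free : Free e w
      free = Admissible⇒Free adm
      -- Both indices turn out to be `k - 1`, so the claim is `- S v' ≤ S v + 1`; both heights are
      -- nonnegative by `height-last`.
      middle : v < k → v' < k → S (suc (suc v)) - S v' ℤ.≤ S v - S (suc (suc v')) ℤ.+ 1ℤ
      middle v<k v'<k = goal
        where
        both : suc v + suc v' ≡ k + k + e
        both = trans (ℕ.+-suc (suc v) v') (trans eq (sym (ℕ.+-assoc k k e)))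
        e≡0 : e ≡ 0
        e≡0 = ℕ.n≤0⇒n≡0 (ℕ.+-cancelˡ-≤ (k + k) e 0 (subst₂ _≤_ both (sym (ℕ.+-identityʳ (k + k)))
          (ℕ.+-mono-≤ v<k v'<k)))
        v≡ : k ≡ suc v
        v≡ = ℕ.≤-antisym (ℕ.+-cancelʳ-≤ k k (suc v)
          (subst (_≤ suc v + k) (trans both (trans (cong (_+_ (k + k)) e≡0) (ℕ.+-identityʳ _)))
          (ℕ.+-monoʳ-≤ (suc v) v'<k))) v<k
        v'≡ : k ≡ suc v'
        v'≡ = ℕ.≤-antisym (ℕ.+-cancelˡ-≤ k k (suc v')
          (subst (_≤ k + suc v') (trans both (trans (cong (_+_ (k + k)) e≡0) (ℕ.+-identityʳ _)))
          (ℕ.+-monoˡ-≤ (suc v') v<k))) v'<k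
        0≤S : ∀ v → k ≡ suc v → 0ℤ ℤ.≤ S v
        0≤S v eq = height-last (subst (λ e → Free e w) e≡0 free) v (trans len eq)
        goal : S (suc (suc v)) - S v' ℤ.≤ S v - S (suc (suc v')) ℤ.+ 1ℤ
        goal = subst₂ (λ a b → a - S v' ℤ.≤ S v - b ℤ.+ 1ℤ)
          (sym (S-beyond (ℕ.≤-trans (ℕ.≤-reflexive v≡) (ℕ.n≤1+n _))))
          (sym (S-beyond (ℕ.≤-trans (ℕ.≤-reflexive v'≡) (ℕ.n≤1+n _))))
          (linear-≤ℤ 1 (ℤ.+-mono-≤ (0≤S v v≡) (0≤S v' v'≡)) (identity (S v) (S v')))
          where
          identity : ∀ a b → a - 0ℤ ℤ.+ 1ℤ ℤ.+ (0ℤ ℤ.+ 0ℤ) ≡ 0ℤ - b ℤ.+ (a ℤ.+ b) ℤ.+ + 1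
          identity = ℤSolver.solve-∀

    k≤s-1 : ∀ {v} → suc v ≡ s → k ≤ v
    k≤s-1 {v} eq = ℕ.s≤s⁻¹ (subst (suc k ≤_) (sym eq)
      (subst (_≤ s) (ℕ.+-comm k 1) (ℕ.+-monoʳ-≤ k nonzero)))

    B₀ : B 0 ≡ + c
    B₀ = trans (cong (λ x → S 0 - x) (S-beyond (ℕ.m≤m+n k (k + e))))
      (trans (ℤ.+-identityʳ (S 0)) (Admissible-height adm))

    c≤1 : + c ℤ.≤ 1ℤ
    c≤1 = bound adm
      where
      bound : ∀ {c} → Admissible e w c → + c ℤ.≤ 1ℤ
      bound (outside _ _) = +≤+ z≤n
      bound (inside _ _)  = ℤ.≤-refl

    Bs : B s ≡ - + c
    Bs = trans (negate (B 0) (B s) (wordHeight-mirror s w {0} refl)) (cong -_ B₀)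
      where
      negate : ∀ a b → a ℤ.+ b ≡ 0ℤ → b ≡ - a
      negate a b eq = trans (identity a b) (trans (cong (_- a) eq) (ℤ.+-identityˡ (- a)))
        where
        identity : ∀ a b → b ≡ a ℤ.+ b - a
        identity = ℤSolver.solve-∀

    -- Both windows of `skip` across the end of a period reduce to this. For `c ≡ 1` it says that
    -- the first letter is not `U`, which `Plain` guarantees.
    B₁-bound : B 1 ℤ.+ + c ℤ.≤ + 2
    B₁-bound = bound adm (ℕ.m≤n⇒∃[o]m+o≡n (ℕ.≤-trans nonzero (ℕ.m≤n+m (k + e) k)))
      where
      Plain-drop : ∀ {w} → Plain e w → height (drop 1 w) ℤ.≤ height w
      Plain-drop (flat _) = ℤ.≤-refl
      Plain-drop (fall _) = ℤ.i≤i+j _ 1ℤ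
      bound : ∀ {c} → Admissible e w c → ∃[ v' ] 1 + v' ≡ s → B 1 ℤ.+ + c ℤ.≤ + 2
      bound (outside f h) (v' , eq) = ℤ.≤-trans (ℤ.≤-reflexive (ℤ.+-identityʳ (B 1)))
        (ℤ.≤-trans (subst (λ b → B 1 ℤ.≤ b ℤ.+ 1ℤ) B0 (B-up 0 v' eq)) (+≤+ (s≤s z≤n)))
        where
        B0 : B 0 ≡ 0ℤ
        B0 = trans (cong (λ x → S 0 - x) (S-beyond (ℕ.m≤m+n k (k + e))))
          (trans (ℤ.+-identityʳ (S 0)) h)
      bound (inside p h) (v' , eq) = subst (λ b → b ℤ.+ 1ℤ ℤ.≤ + 2)
        (sym (trans (B-split 1 v' eq) (cong (λ x → S 1 - x) (S-beyond (k≤s-1 eq)))))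
        (ℤ.+-monoˡ-≤ 1ℤ (ℤ.≤-trans (ℤ.≤-reflexive (ℤ.+-identityʳ (S 1)))
          (subst (S 1 ℤ.≤_) h (Plain-drop p))))

    B-bound : ∀ v v' → v + v' ≡ s → B v ℤ.≤ + (k + k)
    B-bound v v' eq = subst (ℤ._≤ + (k + k)) (sym (B-split v v' eq))
      (ℤ.+-mono-≤ (small v) (subst (- S v' ℤ.≤_) (ℤ.neg-involutive (+ k))
      (ℤ.neg-mono-≤ (large v'))))
      where
      shorter : ∀ v → length (drop v w) ≤ k
      shorter v = ℕ.≤-trans (ℕ.≤-reflexive (List.length-drop v w))
        (ℕ.≤-trans (ℕ.m∸n≤m (length w) v) (ℕ.≤-reflexive len))
      small : ∀ v → S v ℤ.≤ + k
      small v = ℤ.≤-trans (proj₁ (height-bound (drop v w))) (+≤+ (shorter v))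
      large : ∀ v → - + k ℤ.≤ S v
      large v = ℤ.≤-trans (ℤ.neg-mono-≤ (+≤+ (shorter v))) (proj₂ (height-bound (drop v w)))

    P : ℕ → ℤ
    P = wordProfile s w

    P-at : ∀ v v' q → v + v' ≡ s → P (v + q ℕ.* suc s) ≡ B v - + q
    P-at v v' q eq = wordProfile-at s w (subst (v ≤_) eq (ℕ.m≤m+n v v')) q

    shifted : ∀ a b q → a ℤ.≤ b ℤ.+ 1ℤ → a - q ℤ.≤ b - q ℤ.+ 1ℤ
    shifted a b q h = linear-≤ℤ 0 h (identity a b q)
      where
      identity : ∀ a b q → b - q ℤ.+ 1ℤ ℤ.+ a ≡ a - q ℤ.+ (b ℤ.+ 1ℤ) ℤ.+ + 0
      identity = ℤSolver.solve-∀

    -- Compares a height `a` at the start of lap `q + 1`, already lowered by one, with the mirrored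
    -- height `- b` at the end of lap `q`.
    wrapped : ∀ a b q → a ℤ.+ b ℤ.≤ + 2 → a - (1ℤ ℤ.+ q) ℤ.≤ - b - q ℤ.+ 1ℤ
    wrapped a b q h = linear-≤ℤ 0 h (identity a b q)
      where
      identity : ∀ a b q → - b - q ℤ.+ 1ℤ ℤ.+ (a ℤ.+ b) ≡ a - (1ℤ ℤ.+ q) ℤ.+ + 2 ℤ.+ + 0
      identity = ℤSolver.solve-∀

    s+0 : s + 0 ≡ s
    s+0 = ℕ.+-identityʳ s

    P-period : ∀ n → P (n + suc s) ≡ P n - 1ℤ
    P-period = periodically s (λ n → P (n + suc s) ≡ P n - 1ℤ) λ v v' q eq → begin
      P (v + q ℕ.* suc s + suc s)    ≡⟨ cong P (rearrange v (q ℕ.* suc s) (suc s)) ⟩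
      P (v + suc q ℕ.* suc s)        ≡⟨ P-at v v' (suc q) eq ⟩
      B v - + suc q                  ≡⟨ identity (B v) (+ q) ⟩
      B v - + q - 1ℤ                 ≡⟨ cong (_- 1ℤ) (P-at v v' q eq) ⟨
      P (v + q ℕ.* suc s) - 1ℤ       ∎
      where
      open ≡-Reasoning
      rearrange : ∀ v x t → v + x + t ≡ v + (t + x)
      rearrange = ℕSolver.solve-∀
      identity : ∀ b q → b - (1ℤ ℤ.+ q) ≡ b - q - 1ℤ
      identity = ℤSolver.solve-∀

    P-up : ∀ n → P (suc n) ℤ.≤ P n ℤ.+ 1ℤ
    P-up = periodically s (λ n → P (suc n) ℤ.≤ P n ℤ.+ 1ℤ) λ
      { v (suc v') q eq → let eq' = trans (sym (ℕ.+-suc v v')) eq in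
          subst₂ (λ a b → a ℤ.≤ b ℤ.+ 1ℤ) (sym (P-at (suc v) v' q eq')) (sym (P-at v (suc v') q eq))
            (shifted (B (suc v)) (B v) (+ q) (B-up v v' eq'))
      ; v zero q eq → subst (λ v → P (suc v + q ℕ.* suc s) ℤ.≤ P (v + q ℕ.* suc s) ℤ.+ 1ℤ)
          (trans (sym eq) (ℕ.+-identityʳ v))
          (subst₂ (λ a b → a ℤ.≤ b ℤ.+ 1ℤ)
            (sym (trans (P-at 0 s (suc q) refl) (cong (_- + suc q) B₀)))
            (sym (trans (P-at s 0 q s+0) (cong (_- + q) Bs)))
            (wrapped (+ c) (+ c) (+ q) (ℤ.+-mono-≤ c≤1 c≤1))) }

    P-down : ∀ n → P n ℤ.≤ P (suc n) ℤ.+ 1ℤ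
    P-down = periodically s (λ n → P n ℤ.≤ P (suc n) ℤ.+ 1ℤ) λ
      { v (suc v') q eq → let eq' = trans (sym (ℕ.+-suc v v')) eq in
          subst₂ (λ a b → a ℤ.≤ b ℤ.+ 1ℤ) (sym (P-at v (suc v') q eq)) (sym (P-at (suc v) v' q eq'))
            (shifted (B v) (B (suc v)) (+ q) (B-down v v' eq'))
      ; v zero q eq → subst (λ v → P (v + q ℕ.* suc s) ℤ.≤ P (suc v + q ℕ.* suc s) ℤ.+ 1ℤ)
          (trans (sym eq) (ℕ.+-identityʳ v))
          (subst₂ (λ a b → a ℤ.≤ b ℤ.+ 1ℤ)
            (sym (trans (P-at s 0 q s+0) (cong (_- + q) Bs)))
            (sym (trans (P-at 0 s (suc q) refl) (cong (_- + suc q) B₀)))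
            (linear-≤ℤ 0 (ℤ.+-mono-≤ (0≤c c) (0≤c c)) (identity (+ c) (+ q)))) }
      where
      0≤c : ∀ c → 0ℤ ℤ.≤ + c
      0≤c c = +≤+ z≤n
      identity : ∀ c q → c - (1ℤ ℤ.+ q) ℤ.+ 1ℤ ℤ.+ (0ℤ ℤ.+ 0ℤ) ≡ - c - q ℤ.+ (c ℤ.+ c) ℤ.+ + 0
      identity = ℤSolver.solve-∀

    P-skip : ∀ n → P (suc (suc n)) ℤ.≤ P n ℤ.+ 1ℤ
    P-skip = periodically s (λ n → P (suc (suc n)) ℤ.≤ P n ℤ.+ 1ℤ) λ
      { v (suc (suc v')) q eq → let eq' = trans (sym (trans (ℕ.+-suc v (suc v')) (cong suc (ℕ.+-suc v v')))) eq in
          subst₂ (λ a b → a ℤ.≤ b ℤ.+ 1ℤ) (sym (P-at (suc (suc v)) v' q eq'))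
            (sym (P-at v (suc (suc v')) q eq))
            (shifted (B (suc (suc v))) (B v) (+ q) (B-skip v v' eq'))
      ; v (suc zero) q eq → subst (λ u → P (suc u + q ℕ.* suc s) ℤ.≤ P (v + q ℕ.* suc s) ℤ.+ 1ℤ)
          (trans (sym eq) (ℕ.+-comm v 1))
          (subst₂ (λ a b → a ℤ.≤ b ℤ.+ 1ℤ)
            (sym (trans (P-at 0 s (suc q) refl) (cong (_- + suc q) B₀)))
            (sym (trans (P-at v 1 q eq) (cong (_- + q) (mirrored v eq))))
            (wrapped (+ c) (B 1) (+ q) (subst (ℤ._≤ + 2) (ℤ.+-comm (B 1) (+ c)) B₁-bound)))
      ; v zero q eq → subst (λ v → P (suc (suc v) + q ℕ.* suc s) ℤ.≤ P (v + q ℕ.* suc s) ℤ.+ 1ℤ)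
          (trans (sym eq) (ℕ.+-identityʳ v))
          (subst₂ (λ a b → a ℤ.≤ b ℤ.+ 1ℤ)
            (sym (P-at 1 (s ∸ 1) (suc q) (ℕ.m+[n∸m]≡n (ℕ.≤-trans nonzero (ℕ.m≤n+m (k + e) k)))))
            (sym (trans (P-at s 0 q s+0) (cong (_- + q) Bs)))
            (wrapped (B 1) (+ c) (+ q) B₁-bound)) }
      where
      mirrored : ∀ v → v + 1 ≡ s → B v ≡ - B 1
      mirrored v eq = trans (identity (B v) (B 1))
        (trans (cong (_- B 1) (wordHeight-mirror s w {v} {1} eq)) (ℤ.+-identityˡ (- B 1)))
        where
        identity : ∀ a b → a ≡ a ℤ.+ b - b
        identity = ℤSolver.solve-∀

  wordProfile-small : ∀ v v' → v + v' ≡ s → P v ≡ B v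
  wordProfile-small v v' eq = trans (cong P (sym (ℕ.+-identityʳ v)))
    (trans (P-at v v' 0 eq) (ℤ.+-identityʳ (B v)))

  wordProfile-isProfile : Profile s P
  wordProfile-isProfile = record
    { period = P-period
    ; mirror = λ n n' eq → trans (cong₂ ℤ._+_ (wordProfile-small n n' eq)
        (wordProfile-small n' n (trans (ℕ.+-comm n' n) eq)))
                             (wordHeight-mirror s w {n} {n'} eq)
    ; up     = P-up
    ; down   = P-down
    ; skip   = P-skip
    }

  -- Heights never exceed `k + k`, so neither does the number of laps holding beads. This finite
  -- range makes it possible to list the beads by filtering.
  wordProfile-bounded : ∀ n → 1ℤ ℤ.≤ P n → n < (k + k) ℕ.* suc s
  wordProfile-bounded = periodically s (λ n → 1ℤ ℤ.≤ P n → n < (k + k) ℕ.* suc s) λ v v' q eq 1≤P →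
    ℕ.<-≤-trans (ℕ.+-monoˡ-< (q ℕ.* suc s) (s≤s (subst (v ≤_) eq (ℕ.m≤m+n v v'))))
      (ℕ.*-monoˡ-≤ (suc s) (ℤ.drop‿+≤+
        (linear-≤ℤ 0 (ℤ.+-mono-≤ (subst (1ℤ ℤ.≤_) (P-at v v' q eq) 1≤P) (B-bound v v' eq))
        (identity (B v) (+ q) (+ (k + k))))))
    where
    identity : ∀ b q k → k ℤ.+ (1ℤ ℤ.+ b) ≡ 1ℤ ℤ.+ q ℤ.+ (b - q ℤ.+ k) ℤ.+ + 0
    identity = ℤSolver.solve-∀

-- Reading the word off a profile

small-double : ∀ c → c ℤ.+ c ℤ.≤ 1ℤ → - 1ℤ ℤ.≤ c ℤ.+ c → c ≡ 0ℤ
small-double (+ zero)  _           _             = refl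
small-double (+ suc n) (+≤+ (s≤s h)) _           = contradiction (subst (_≤ 0) (ℕ.+-suc n n) h) λ ()
small-double -[1+ n ]  _           (ℤ.-≤- ())

zero-or-one : ∀ c → c ℤ.+ c ℤ.≤ + 2 → 0ℤ ℤ.≤ c ℤ.+ c → c ≡ 0ℤ ⊎ c ≡ 1ℤ
zero-or-one (+ zero)        _                    _  = inj₁ refl
zero-or-one (+ suc zero)    _                    _  = inj₂ refl
zero-or-one (+ suc (suc n)) (+≤+ (s≤s (s≤s h)))  _  =
  contradiction (subst (_≤ 0) (ℕ.+-suc n (suc n)) h) λ ()
zero-or-one -[1+ n ]        _                    ()

trichotomy : ∀ a b → b ℤ.≤ a ℤ.+ 1ℤ → a ℤ.≤ b ℤ.+ 1ℤ → b ≡ a ℤ.+ 1ℤ ⊎ b ≡ a ⊎ a ≡ b ℤ.+ 1ℤ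
trichotomy a b b≤ a≤ with ℤ.<-cmp a b
... | tri≈ _ a≡b _ = inj₂ (inj₁ (sym a≡b))
... | tri< a<b _ _ = inj₁ (ℤ.≤-antisym b≤ (subst (ℤ._≤ b) (ℤ.+-comm 1ℤ a) (ℤ.i<j⇒suc[i]≤j a<b)))
... | tri> _ _ b<a = inj₂ (inj₂
  (ℤ.≤-antisym a≤ (subst (ℤ._≤ a) (ℤ.+-comm 1ℤ b) (ℤ.i<j⇒suc[i]≤j b<a))))

1≰0 : ¬ 1ℤ ℤ.≤ 0ℤ
1≰0 (+≤+ ())

Profile-at : ∀ {s C} → Profile s C → ∀ v q → C (v + q ℕ.* suc s) ≡ C v - + q
Profile-at {s} {C} profile v zero    = trans (cong C (ℕ.+-identityʳ v)) (sym (ℤ.+-identityʳ (C v)))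
Profile-at {s} {C} profile v (suc q) = begin
  C (v + (suc s + q ℕ.* suc s))    ≡⟨ cong C (rearrange v (suc s) (q ℕ.* suc s)) ⟩
  C (v + q ℕ.* suc s + suc s)      ≡⟨ Profile.period profile _ ⟩
  C (v + q ℕ.* suc s) - 1ℤ         ≡⟨ cong (_- 1ℤ) (Profile-at profile v q) ⟩
  C v - + q - 1ℤ                   ≡⟨ identity (C v) (+ q) ⟩
  C v - + suc q                    ∎
  where
  open ≡-Reasoning
  rearrange : ∀ v t x → v + (t + x) ≡ v + x + t
  rearrange = ℕSolver.solve-∀
  identity : ∀ c q → c - q - 1ℤ ≡ c - (1ℤ ℤ.+ q)
  identity = ℤSolver.solve-∀

Profile-mirror : ∀ {s C} → Profile s C → ∀ v v' → v + v' ≡ s → C v ≡ - C v'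
Profile-mirror {C = C} profile v v' eq = trans (identity (C v) (C v'))
  (trans (cong (_- C v') (Profile.mirror profile v v' eq)) (ℤ.+-identityˡ (- C v')))
  where
  identity : ∀ a b → a ≡ a ℤ.+ b - b
  identity = ℤSolver.solve-∀

Represents-positive : ∀ {s C C' as} → Profile s C → Profile s C' → Represents C as →
  Represents C' as →
  ∀ v q → + suc q ℤ.≤ C v → + suc q ℤ.≤ C' v
Represents-positive {s} {C} {C'} profile profile' rep rep' v q h =
  linear-≤ℤ 0 (subst (1ℤ ℤ.≤_) (Profile-at profile' v q)
    (to (rep' _) (from (rep _) (subst (1ℤ ℤ.≤_) (sym (Profile-at profile v q))
      (linear-≤ℤ 0 h (identity₁ (C v) (+ q)))))))
    (identity₂ (C' v) (+ q))
  where
  identity₁ : ∀ c q → c - q ℤ.+ (1ℤ ℤ.+ q) ≡ 1ℤ ℤ.+ c ℤ.+ + 0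
  identity₁ = ℤSolver.solve-∀
  identity₂ : ∀ c q → c ℤ.+ 1ℤ ≡ 1ℤ ℤ.+ q ℤ.+ (c - q) ℤ.+ + 0
  identity₂ = ℤSolver.solve-∀

-- The set `as` shows only positive heights. A negative height is recovered at the mirror index,
-- where it turns positive.
Represents-≤ : ∀ {s C C' as} → Profile s C → Profile s C' → Represents C as → Represents C' as →
  ∀ v v' → v + v' ≡ s → C v ℤ.≤ C' v
Represents-≤ {C = C} {C'} profile profile' rep rep' v v' eq with C v in Cv | C' v in C'v
... | + suc q   | _        = subst (+ suc q ℤ.≤_) C'v (Represents-positive profile profile' rep rep'
  v q (ℤ.≤-reflexive (sym Cv)))
... | + zero    | + _      = +≤+ z≤n
... | -[1+ _ ]  | + _      = ℤ.-≤+
... | c         | -[1+ q ] = subst₂ ℤ._≤_ (trans (sym (Profile-mirror profile v v' eq)) Cv) refl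
  (ℤ.neg-mono-≤ (Represents-positive profile' profile rep' rep v' q
    (ℤ.≤-reflexive (sym (trans (Profile-mirror profile' v' v (trans (ℕ.+-comm v' v) eq))
      (cong -_ C'v))))))

module _ {k e C} (e≤1 : e ≤ 1) (profile : Profile (k + (k + e)) C) where
  open Profile profile

  private
    s : ℕ
    s = k + (k + e)

    -- For `e ≡ 0` the index `k` is its own mirror image. For `e ≡ 1` the next height is `- C k`,
    -- and a step of size at most one bounds `C k + C k` by one in absolute value.
    middle : C k ≡ 0ℤ
    middle = split e≤1 (mirror k (k + e) refl)
      where
      low : ∀ a b → a ≡ b → 0ℤ ℤ.≤ a ℤ.+ b → - 1ℤ ℤ.≤ a ℤ.+ a
      low a b refl h = ℤ.≤-trans ℤ.-≤+ h
      split : ∀ {e} → e ≤ 1 → C k ℤ.+ C (k + e) ≡ 0ℤ → C k ≡ 0ℤ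
      split z≤n eq = small-double (C k) (ℤ.≤-trans (ℤ.≤-reflexive double) 0≤1)
        (ℤ.≤-trans ℤ.-≤+ (ℤ.≤-reflexive (sym double)))
        where
        double : C k ℤ.+ C k ≡ 0ℤ
        double = trans (cong (λ x → C k ℤ.+ C x) (sym (ℕ.+-identityʳ k))) eq
      split (s≤s z≤n) eq' = small-double (C k)
        (linear-≤ℤ 0 (ℤ.+-mono-≤ (down k) (ℤ.≤-reflexive eq)) (identity₁ (C k) (C (suc k))))
        (linear-≤ℤ 0 (ℤ.+-mono-≤ (up k) (ℤ.≤-reflexive (sym eq))) (identity₂ (C k) (C (suc k))))
        where
        eq : C k ℤ.+ C (suc k) ≡ 0ℤ
        eq = trans (cong (λ x → C k ℤ.+ C x) (ℕ.+-comm 1 k)) eq'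
        identity₁ : ∀ a b → 1ℤ ℤ.+ (a ℤ.+ (a ℤ.+ b)) ≡ a ℤ.+ a ℤ.+ (b ℤ.+ 1ℤ ℤ.+ 0ℤ) ℤ.+ + 0
        identity₁ = ℤSolver.solve-∀
        identity₂ : ∀ a b → a ℤ.+ a ℤ.+ (b ℤ.+ 0ℤ) ≡ - 1ℤ ℤ.+ (a ℤ.+ 1ℤ ℤ.+ (a ℤ.+ b)) ℤ.+ + 0
        identity₂ = ℤSolver.solve-∀

    C-s : C s ≡ - C 0
    C-s = Profile-mirror profile s 0 (ℕ.+-identityʳ s)

    -- The step from `s` to `s + 1` has size `C 0 + C 0 - 1`, which must be -1, 0 or 1.
    start : C 0 ≡ 0ℤ ⊎ C 0 ≡ 1ℤ
    start = zero-or-one (C 0)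
      (linear-≤ℤ 0 (subst₂ (λ a b → a ℤ.≤ b ℤ.+ 1ℤ) (period 0) C-s (up s)) (identity₁ (C 0)))
      (linear-≤ℤ 0 (subst₂ (λ a b → a ℤ.≤ b ℤ.+ 1ℤ) C-s (period 0) (down s)) (identity₂ (C 0)))
      where
      identity₁ : ∀ c → + 2 ℤ.+ (c - 1ℤ) ≡ c ℤ.+ c ℤ.+ (- c ℤ.+ 1ℤ) ℤ.+ + 0
      identity₁ = ℤSolver.solve-∀
      identity₂ : ∀ c → c ℤ.+ c ℤ.+ - c ≡ 0ℤ ℤ.+ (c - 1ℤ ℤ.+ 1ℤ) ℤ.+ + 0
      identity₂ = ℤSolver.solve-∀

    -- `skip` from `s` to `s + 2`, that is, from `-1` to `C 1 - 1`.
    first-step : C 0 ≡ 1ℤ → C 1 ℤ.≤ 1ℤ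
    first-step C0 = linear-≤ℤ 0 (subst₂ (λ a b → a ℤ.≤ b ℤ.+ 1ℤ) (period 1) (trans C-s (cong -_ C0))
      (skip s)) (identity (C 1))
      where
      identity : ∀ c → 1ℤ ℤ.+ (c - 1ℤ) ≡ c ℤ.+ (- 1ℤ ℤ.+ 1ℤ) ℤ.+ + 0
      identity = ℤSolver.solve-∀

    -- A final rise means `C (k - 1) = -1`. For `e ≡ 0` the mirror image gives `C (k + 1) = 1`, and
    -- the two contradict `skip` across the middle.
    last-step : ∀ v → suc v ≡ k → C (suc v) ≡ C v ℤ.+ 1ℤ → e ≡ 1
    last-step v sv≡k rise = parity e≤1 refl
      where
      identity : ∀ a b c → 0ℤ ℤ.+ (c ℤ.+ 0ℤ ℤ.+ (a ℤ.+ 1ℤ ℤ.+ b ℤ.+ (a ℤ.+ 1ℤ ℤ.+ b))) ≡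
        1ℤ ℤ.+ (a ℤ.+ 1ℤ ℤ.+ (a ℤ.+ c) ℤ.+ (b ℤ.+ 0ℤ ℤ.+ (b ℤ.+ 0ℤ))) ℤ.+ + 0
      identity = ℤSolver.solve-∀
      bottom : C v ℤ.+ 1ℤ ℤ.+ C (suc v) ℤ.≤ C (suc v) ℤ.+ 0ℤ
      bottom = ℤ.+-mono-≤ (ℤ.≤-reflexive (sym rise)) (ℤ.≤-reflexive (trans (cong C sv≡k) middle))
      opposite : 0 ≡ e → C v ℤ.+ C (suc (suc v)) ≡ 0ℤ
      opposite 0≡e = mirror v (suc (suc v))
        (trans (ℕ.+-suc v (suc v))
          (cong₂ _+_ sv≡k (trans (sym (ℕ.+-identityʳ (suc v))) (cong₂ _+_ sv≡k 0≡e))))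
      parity : ∀ {e'} → e' ≤ 1 → e' ≡ e → e ≡ 1
      parity (s≤s z≤n) 1≡e = sym 1≡e
      parity z≤n       0≡e = contradiction (linear-≤ℤ 0 (ℤ.+-mono-≤
        (ℤ.+-mono-≤ (skip v) (ℤ.≤-reflexive (sym (opposite 0≡e)))) (ℤ.+-mono-≤ bottom bottom))
        (identity (C v) (C (suc v)) (C (suc (suc v))))) 1≰0

    WordFrom : ℕ → ℕ → Set
    WordFrom v n = ∃[ w ] length w ≡ n × Free e w ×
      (∀ i j → i + j ≡ n → height (drop i w) ≡ C (v + i))

    -- Built backwards from the middle, where the height is known to be 0; the difference of
    -- consecutive heights dictates each letter.
    wordFrom : ∀ n v → v + n ≡ k → WordFrom v n
    wordFrom zero    v eq = [] , refl , empty ,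
      λ { zero zero refl → trans (sym middle) (cong C (sym eq)) }
    wordFrom (suc n) v eq with wordFrom n (suc v) (trans (sym (ℕ.+-suc v n)) eq)
    ... | w , len , free , heights = extend (trichotomy (C v) (C (suc v)) (up v) (down v))
      where
      next : height w ≡ C (suc v)
      next = trans (heights 0 n refl) (cong C (ℕ.+-identityʳ (suc v)))
      heights-∷ : ∀ x → height (x ∷ w) ≡ C v → ∀ i j → i + j ≡ suc n → height (drop i (x ∷ w)) ≡ C
        (v + i)
      heights-∷ x h zero    j _    = trans h (cong C (sym (ℕ.+-identityʳ v)))
      heights-∷ x h (suc i) j refl = trans (heights i j refl) (cong C (sym (ℕ.+-suc v i)))
      -- A `U` may precede a non-`U` letter or, for odd `s`, end the word; before another `U` it
      -- would violate `skip`.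
      climb-free : ∀ w → length w ≡ n → Free e w → height w ≡ C (suc v) → height (drop 1 w) ≡ C
        (suc (suc v)) ⊎ w ≡ [] →
        C (suc v) ≡ C v ℤ.+ 1ℤ → Free e (U ∷ w)
      climb-free []      len  f         h _         rise =
        last (last-step v (trans (ℕ.+-comm 1 v) (trans (cong (λ m → v + suc m) len) eq)) rise)
      climb-free (_ ∷ _) len  (plain p) h _         rise = climb p
      climb-free (U ∷ w) len  _         h (inj₁ h') rise = contradiction
        (linear-≤ℤ 0 (ℤ.+-mono-≤ (subst (ℤ._≤ C v ℤ.+ 1ℤ) (sym h') (skip v))
          (ℤ.≤-reflexive (sym (trans h rise)))) (identity (C v) (height w))) 1≰0
        where
        identity : ∀ c h → 0ℤ ℤ.+ (h ℤ.+ (c ℤ.+ 1ℤ)) ≡ 1ℤ ℤ.+ (c ℤ.+ 1ℤ ℤ.+ (h - 1ℤ)) ℤ.+ + 0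
        identity = ℤSolver.solve-∀
      second : ∀ w → length w ≡ n → (∀ i j → i + j ≡ n → height (drop i w) ≡ C (suc v + i)) →
        height (drop 1 w) ≡ C (suc (suc v)) ⊎ w ≡ []
      second []      _    _ = inj₂ refl
      second (x ∷ w) len  h = inj₁
        (trans (h 1 (length w) len)
        (cong C (trans (ℕ.+-suc (suc v) 0) (cong suc (ℕ.+-identityʳ (suc v))))))
      extend : C (suc v) ≡ C v ℤ.+ 1ℤ ⊎ C (suc v) ≡ C v ⊎ C v ≡ C (suc v) ℤ.+ 1ℤ →
        WordFrom v (suc n)
      extend (inj₁ rise) = U ∷ w , cong suc len , climb-free w len free next (second w len heights)
        rise ,
        heights-∷ U (trans (cong (_- 1ℤ) (trans next rise)) (identity (C v)))
        where
        identity : ∀ c → c ℤ.+ 1ℤ - 1ℤ ≡ c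
        identity = ℤSolver.solve-∀
      extend (inj₂ (inj₁ same)) = F ∷ w , cong suc len , plain (flat free) ,
        heights-∷ F (trans next same)
      extend (inj₂ (inj₂ drops)) = D ∷ w , cong suc len , plain (fall free) ,
        heights-∷ D (trans (cong (ℤ._+ 1ℤ) next) (sym drops))

  profile⇒word : ∃[ c ] ∃[ w ] length w ≡ k × Admissible e w c × (∀ n → wordProfile s w n ≡ C n)
  profile⇒word with wordFrom k 0 refl
  ... | w , len , free , heights = _ , w , len , proj₂ (admissible start) , periodically s _ agree
    where
    height₀ : height w ≡ C 0
    height₀ = heights 0 k refl
    not-rising : ∀ w → Free e w → height w ≡ 1ℤ → (∀ {x w'} → w ≡ x ∷ w' → height w' ℤ.≤ 1ℤ) →
      Plain e w
    not-rising (_ ∷ _) (plain p) h _ = p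
    not-rising (U ∷ w) _         h b = contradiction
      (linear-≤ℤ 0 (ℤ.+-mono-≤ (b refl) (ℤ.≤-reflexive (sym h))) (identity (height w))) 1≰0
      where
      identity : ∀ h → 0ℤ ℤ.+ (h ℤ.+ 1ℤ) ≡ 1ℤ ℤ.+ (1ℤ ℤ.+ (h - 1ℤ)) ℤ.+ + 0
      identity = ℤSolver.solve-∀
    admissible : C 0 ≡ 0ℤ ⊎ C 0 ≡ 1ℤ → ∃ (Admissible e w)
    admissible (inj₁ C0) = 0 , outside free (trans height₀ C0)
    admissible (inj₂ C0) = 1 , inside (not-rising w free (trans height₀ C0) second)
      (trans height₀ C0)
      where
      second : ∀ {x w'} → w ≡ x ∷ w' → height w' ℤ.≤ 1ℤ
      second {x} {w'} eq = subst (ℤ._≤ 1ℤ)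
        (trans (sym (heights 1 (length w') (trans (cong length (sym eq)) len)))
          (cong (λ w → height (drop 1 w)) eq)) (first-step C0)
    inner : ∀ {v} → v ≤ k → height (drop v w) ≡ C v
    inner {v} v≤k = heights v (k ∸ v) (ℕ.m+[n∸m]≡n v≤k)
    beyond : ∀ {v} → k ≤ v → height (drop v w) ≡ 0ℤ
    beyond k≤v = height-beyond w (subst (_≤ _) (sym len) k≤v)
    half : ∀ v v' → v + v' ≡ s → wordHeight s w v ≡ C v
    half v v' eq with v ≤? k
    ... | yes v≤k = trans (wordHeight-split s w v v' eq)
      (trans (cong₂ _-_ (inner v≤k) (beyond (far {k} {e} eq v≤k))) (ℤ.+-identityʳ (C v)))
    ... | no v≰k  = trans (wordHeight-split s w v v' eq)
      (trans (cong₂ _-_ (beyond (ℕ.<⇒≤ (ℕ.≰⇒> v≰k))) (inner v'≤k))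
        (trans (ℤ.+-identityˡ (- C v')) (sym (Profile-mirror profile v v' eq))))
      where
      v'≤k : v' ≤ k
      v'≤k = linear-≤ 0 (ℕ.+-mono-≤ (ℕ.≰⇒> v≰k) e≤1)
        (trans (identity₁ k e) (trans (cong (λ x → suc x) (sym eq)) (identity₂ v v')))
        where
        identity₁ : ∀ k e → k + (suc k + e) ≡ suc (k + (k + e))
        identity₁ = ℕSolver.solve-∀
        identity₂ : ∀ v v' → suc (v + v') ≡ v' + (v + 1) + 0
        identity₂ = ℕSolver.solve-∀
    agree : ∀ v v' q → v + v' ≡ s → wordProfile s w (v + q ℕ.* suc s) ≡ C (v + q ℕ.* suc s)
    agree v v' q eq = trans (wordProfile-at s w (subst (v ≤_) eq (ℕ.m≤m+n v v')) q)
      (trans (cong (_- + q) (half v v' eq)) (sym (Profile-at profile v q)))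

Decreasing-extensional : ∀ {as bs} → Decreasing as → Decreasing bs → (∀ n → n ∈ as ⇔ n ∈ bs) →
  as ≡ bs
Decreasing-extensional {[]}     {[]}     _ _ _ = refl
Decreasing-extensional {[]}     {b ∷ bs} _ _ h = contradiction (from (h b) (here refl)) λ ()
Decreasing-extensional {a ∷ as} {[]}     _ _ h = contradiction (to (h a) (here refl)) λ ()
Decreasing-extensional {a ∷ as} {b ∷ bs} (a>as ∷ das) (b>bs ∷ dbs) h = cong₂ _∷_ heads
  (Decreasing-extensional das dbs λ n → mk⇔ (tail das a>as b>bs heads (to (h n)))
    (tail dbs b>bs a>as (sym heads) (from (h n))))
  where
  at-most : ∀ {a as n} → All (a >_) as → n ∈ a ∷ as → n ≤ a
  at-most _    (here refl) = ℕ.≤-refl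
  at-most a>as (there n∈)  = ℕ.<⇒≤ (All.lookup a>as n∈)
  heads : a ≡ b
  heads = ℕ.≤-antisym (at-most b>bs (to (h a) (here refl))) (at-most a>as (from (h b) (here refl)))
  tail : ∀ {a b as bs n} → Decreasing as → All (a >_) as → All (b >_) bs → a ≡ b →
    (n ∈ a ∷ as → n ∈ b ∷ bs) → n ∈ as → n ∈ bs
  tail _ a>as _ eq f n∈ with f (there n∈)
  ... | there n∈bs = n∈bs
  ... | here n≡b   = contradiction (All.lookup a>as n∈) (ℕ.<-irrefl (trans n≡b (sym eq)))

-- Pigeonhole principle for a relation instead of a function, so that one relation serves both
-- directions of a count.
length-≤-by : ∀ {A B : Set} {xs : List A} {ys : List B} (R : A → B → Set) → Unique xs →
  (∀ {x} → x ∈ xs → ∃[ y ] y ∈ ys × R x y) →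
  (∀ {x x' y} → x ∈ xs → x' ∈ xs → R x y → R x' y → x ≡ x') → length xs ≤ length ys
length-≤-by {xs = []}     R _ _ _ = z≤n
length-≤-by {xs = x ∷ xs} R (x∉ ∷ xs!) total injective with total (here refl)
... | y , y∈ , Rxy with ∈-∃++ y∈
...   | ys₁ , ys₂ , refl =
  ℕ.≤-trans (s≤s (length-≤-by R xs! total' λ m m' → injective (there m) (there m')))
  (ℕ.≤-reflexive (trans (cong suc (List.length-++ ys₁))
    (trans (sym (ℕ.+-suc (length ys₁) (length ys₂))) (sym (List.length-++ ys₁)))))
  where
  total' : ∀ {x'} → x' ∈ xs → ∃[ y' ] y' ∈ ys₁ ++ ys₂ × R x' y'
  total' x'∈ with total (there x'∈)
  ... | y' , y'∈ , Rx'y' with ∈-++⁻ ys₁ y'∈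
  ...   | inj₁ y'∈₁         = y' , ∈-++⁺ˡ y'∈₁ , Rx'y'
  ...   | inj₂ (there y'∈₂) = y' , ∈-++⁺ʳ ys₁ y'∈₂ , Rx'y'
  ...   | inj₂ (here refl)  = contradiction (injective (here refl) (there x'∈) Rxy Rx'y')
    (All.lookup x∉ x'∈)

-- Corners as rises of the word

ups : Word → List ℕ
ups []      = []
ups (U ∷ w) = 0 ∷ map suc (ups w)
ups (F ∷ w) = map suc (ups w)
ups (D ∷ w) = map suc (ups w)

∈-ups : ∀ w i → i ∈ ups w ⇔ (i < length w × height (drop (suc i) w) ≡ height (drop i w) ℤ.+ 1ℤ)
∈-ups []      i = mk⇔ (λ ()) λ { (() , _) }
∈-ups (x ∷ w) i = mk⇔ (forwards x i) (λ (lt , eq) → backwards x i lt eq)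
  where
  identity : ∀ h → h ≡ h - 1ℤ ℤ.+ 1ℤ
  identity = ℤSolver.solve-∀
  later : ∀ x {i} → i ∈ map suc (ups w) →
    i < length (x ∷ w) × height (drop (suc i) (x ∷ w)) ≡ height (drop i (x ∷ w)) ℤ.+ 1ℤ
  later x i∈ with ∈-map⁻ suc i∈
  ... | i' , i'∈ , refl with to (∈-ups w i') i'∈
  ...   | lt , eq = s≤s lt , eq
  rises : ∀ h → h ≢ h ℤ.+ 1ℤ
  rises h eq = ℤ.<-irrefl eq (ℤ.suc[i]≤j⇒i<j (ℤ.≤-reflexive (ℤ.+-comm 1ℤ h)))
  forwards : ∀ x i → i ∈ ups (x ∷ w) → i < length (x ∷ w) × height (drop (suc i) (x ∷ w)) ≡ height
    (drop i (x ∷ w)) ℤ.+ 1ℤ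
  forwards U .0 (here refl) = s≤s z≤n , identity (height w)
  forwards U i  (there i∈) = later U i∈
  forwards F i  i∈ = later F i∈
  forwards D i  i∈ = later D i∈
  backwards : ∀ x i → i < length (x ∷ w) → height (drop (suc i) (x ∷ w)) ≡ height (drop i (x ∷ w))
    ℤ.+ 1ℤ → i ∈ ups (x ∷ w)
  backwards U zero    _        _  = here refl
  backwards F zero    _        eq = contradiction eq (rises (height w))
  backwards D zero    _        eq = contradiction (ℤ.≤-reflexive (sym eq))
    (ℤ.<⇒≱ (ℤ.suc[i]≤j⇒i<j (linear-≤ℤ 1 (ℤ.≤-refl {height w}) (identity' (height w)))))
    where
    identity' : ∀ h → h ℤ.+ 1ℤ ℤ.+ 1ℤ ℤ.+ h ≡ 1ℤ ℤ.+ h ℤ.+ h ℤ.+ + 1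
    identity' = ℤSolver.solve-∀
  backwards U (suc i) (s≤s lt) eq = there (∈-map⁺ suc (from (∈-ups w i) (lt , eq)))
  backwards F (suc i) (s≤s lt) eq = ∈-map⁺ suc (from (∈-ups w i) (lt , eq))
  backwards D (suc i) (s≤s lt) eq = ∈-map⁺ suc (from (∈-ups w i) (lt , eq))

ups-unique : ∀ w → Unique (ups w)
ups-unique []      = []
ups-unique (U ∷ w) = All.map⁺ (All.universal (λ _ ()) (ups w)) ∷ Unique.map⁺ ℕ.suc-injective
  (ups-unique w)
ups-unique (F ∷ w) = Unique.map⁺ ℕ.suc-injective (ups-unique w)
ups-unique (D ∷ w) = Unique.map⁺ ℕ.suc-injective (ups-unique w)

height-injective : ∀ {w w'} → length w ≡ length w' → (∀ v → height (drop v w) ≡ height (drop v w'))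
  → w ≡ w'
height-injective {[]}    {[]}     _   _ = refl
height-injective {x ∷ w} {y ∷ w'} len h = cong₂ _∷_
  (letter x y (trans (sym (height-∷ x w))
    (trans (h 0) (trans (height-∷ y w') (cong (ℤ._+ step y) (sym (h 1)))))))
  (height-injective (ℕ.suc-injective len) (h ∘ suc))
  where
  step : Letter → ℤ
  step U = - 1ℤ
  step F = 0ℤ
  step D = 1ℤ
  height-∷ : ∀ x w → height (x ∷ w) ≡ height w ℤ.+ step x
  height-∷ U w = refl
  height-∷ F w = sym (ℤ.+-identityʳ (height w))
  height-∷ D w = refl
  step-injective : ∀ x y → step x ≡ step y → x ≡ y
  step-injective U U _ = refl
  step-injective F F _ = refl
  step-injective D D _ = refl
  letter : ∀ x y → height w ℤ.+ step x ≡ height w ℤ.+ step y → x ≡ y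
  letter x y eq = step-injective x y (trans (cancel (height w) (step x))
    (trans (cong (_- height w) eq) (sym (cancel (height w) (step y)))))
    where
    cancel : ∀ h a → a ≡ h ℤ.+ a - h
    cancel = ℤSolver.solve-∀

support : ℕ → Word → List ℕ
support s w = filter (λ n → 1ℤ ℤ.≤? wordProfile s w n) (downFrom ((length w + length w) ℕ.* suc s))

support-decreasing : ∀ s w → Decreasing (support s w)
support-decreasing s w = AllPairs.filter⁺ (λ n → 1ℤ ℤ.≤? wordProfile s w n)
  (AllPairs.applyDownFrom⁺₁ id ((length w + length w) ℕ.* suc s) λ j<i _ → j<i)

module _ {k e c w} (nonzero : 1 ≤ k + e) (len : length w ≡ k) (adm : Admissible e w c) where

  private
    s : ℕ
    s = k + (k + e)

    P : ℕ → ℤ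
    P = wordProfile s w

    profile : Profile s P
    profile = wordProfile-isProfile nonzero len adm

    open Profile profile

  support-represents : Represents P (support s w)
  support-represents n = mk⇔
    (proj₂ ∘ ∈-filter⁻ (λ n → 1ℤ ℤ.≤? P n) {xs = downFrom ((length w + length w) ℕ.* suc s)})
    (λ 1≤P → ∈-filter⁺ (λ n → 1ℤ ℤ.≤? P n)
      (∈-downFrom⁺ (subst (λ l → n < (l + l) ℕ.* suc s) (sym len)
      (wordProfile-bounded nonzero len adm n 1≤P))) 1≤P)

  private
    as : List ℕ
    as = support s w

    P-left : ∀ {v} → v ≤ k → P v ≡ height (drop v w)
    P-left {v} v≤k = trans (wordProfile-small nonzero len adm v (s ∸ v) eq)
      (trans (wordHeight-split s w v (s ∸ v) eq)
      (trans (cong (λ x → height (drop v w) - x)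
        (height-beyond w (subst (_≤ s ∸ v) (sym len) (far {k} {e} eq v≤k)))) (ℤ.+-identityʳ _)))
      where
      eq : v + (s ∸ v) ≡ s
      eq = ℕ.m+[n∸m]≡n (ℕ.≤-trans v≤k (ℕ.m≤m+n k (k + e)))

    P₀ : P 0 ≡ + c
    P₀ = trans (P-left z≤n) (Admissible-height adm)

    ups⇒rise : ∀ {i} → i ∈ ups w → i < k × P (suc i) ≡ P i ℤ.+ 1ℤ
    ups⇒rise {i} i∈ with to (∈-ups w i) i∈
    ... | i<l , eq = i<k , trans (P-left i<k) (trans eq (cong (ℤ._+ 1ℤ) (sym (P-left (ℕ.<⇒≤ i<k)))))
      where
      i<k : i < k
      i<k = subst (i <_) len i<l

    rise⇒ups : ∀ {i} → i < k → P (suc i) ≡ P i ℤ.+ 1ℤ → i ∈ ups w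
    rise⇒ups {i} i<k eq = from (∈-ups w i) (subst (i <_) (sym len) i<k ,
      trans (sym (P-left i<k)) (trans eq (cong (ℤ._+ 1ℤ) (P-left (ℕ.<⇒≤ i<k)))))

    -- An up step between i and suc i of the half period occurs on the abacus
    -- either at suc i or, mirrored, at s - i, whichever lies above the origin.
    Matches : ℕ → ℕ → Set
    Matches i n = (∃[ q ] n ≡ suc i + q ℕ.* suc s × P i ≡ + q)
                ⊎ (∃[ q ] n + i ≡ s + q ℕ.* suc s × P i ≡ -[1+ q ])

    start-∈ : ∀ n → P (suc n) ≡ 1ℤ → P n ≡ 0ℤ → suc n ∈ starts as
    start-∈ n P1 P0 = from (∈-starts (support-decreasing s w) (suc n))
      (from (support-represents (suc n)) (ℤ.≤-reflexive (sym P1)) , n , refl ,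
        λ n∈ → 1≰0 (subst (1ℤ ℤ.≤_) P0 (to (support-represents n) n∈)))

    -- A rise from `q` to `q + 1` becomes one from 0 to 1 on lap `q`. A rise from `-(q + 1)` to
    -- `- q` is mirrored to one from `q` to `q + 1` and treated likewise.
    ups⇒starts : ∀ {i} → i ∈ ups w → ∃[ n ] n ∈ starts as × Matches i n
    ups⇒starts {i} i∈ = let i<k , rise = ups⇒rise i∈ in place (P i) refl i<k rise
      where
      Target : Set
      Target = ∃[ n ] n ∈ starts as × Matches i n
      place : ∀ p → P i ≡ p → i < k → P (suc i) ≡ P i ℤ.+ 1ℤ → Target
      place (+ q) Pi i<k rise = suc i + q ℕ.* suc s , start-∈ (i + q ℕ.* suc s)
          (trans (Profile-at profile (suc i) q)
            (trans (cong (_- + q) (trans rise (cong (ℤ._+ 1ℤ) Pi))) (identity₁ (+ q))))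
          (trans (Profile-at profile i q) (trans (cong (_- + q) Pi) (ℤ.+-inverseʳ (+ q)))) ,
          inj₁ (q , refl , Pi)
        where
        identity₁ : ∀ q → q ℤ.+ 1ℤ - q ≡ 1ℤ
        identity₁ = ℤSolver.solve-∀
      place -[1+ q ] Pi i<k rise = suc (j + q ℕ.* suc s) , start-∈ (j + q ℕ.* suc s)
          (trans (Profile-at profile (suc j) q)
            (trans (cong (_- + q) (trans (Profile-mirror profile (suc j) i opposite₁) (cong -_ Pi)))
            (identity₁ (+ q))))
          (trans (Profile-at profile j q)
            (trans (cong (_- + q) (trans (Profile-mirror profile j (suc i) opposite₂)
            (cong -_ (trans rise (cong (ℤ._+ 1ℤ) Pi))))) (identity₂ (+ q)))) ,
          inj₂ (q , trans (rearrange i j (q ℕ.* suc s)) (cong (_+ q ℕ.* suc s) opposite₃) , Pi)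
        where
        j : ℕ
        j = s ∸ suc i
        opposite₃ : suc i + j ≡ s
        opposite₃ = ℕ.m+[n∸m]≡n (ℕ.≤-trans i<k (ℕ.m≤m+n k (k + e)))
        opposite₁ : suc j + i ≡ s
        opposite₁ = trans (cong suc (ℕ.+-comm j i)) opposite₃
        opposite₂ : j + suc i ≡ s
        opposite₂ = trans (ℕ.+-comm j (suc i)) opposite₃
        rearrange : ∀ i j x → suc (j + x) + i ≡ suc i + j + x
        rearrange = ℕSolver.solve-∀
        identity₁ : ∀ q → 1ℤ ℤ.+ q - q ≡ 1ℤ
        identity₁ = ℤSolver.solve-∀
        identity₂ : ∀ q → - (- (1ℤ ℤ.+ q) ℤ.+ 1ℤ) - q ≡ 0ℤ
        identity₂ = ℤSolver.solve-∀

    start⇒up : ∀ v v' q → v + v' ≡ s → suc (v + q ℕ.* suc s) ∈ as → v + q ℕ.* suc s ∉ as →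
      ∃[ i ] i ∈ ups w × Matches i (suc (v + q ℕ.* suc s))
    start⇒up v v' q eq n∈ n'∉ = locate v' eq
      where
      n' : ℕ
      n' = v + q ℕ.* suc s
      1≤P : 1ℤ ℤ.≤ P (suc n')
      1≤P = to (support-represents (suc n')) n∈
      P≤0 : P n' ℤ.≤ 0ℤ
      P≤0 = linear-≤ℤ 0 (≰⇒1+≤ (n'∉ ∘ from (support-represents n'))) (identity (P n'))
        where
        identity : ∀ p → 0ℤ ℤ.+ (1ℤ ℤ.+ p) ≡ p ℤ.+ 1ℤ ℤ.+ + 0
        identity = ℤSolver.solve-∀
      P0 : P n' ≡ 0ℤ
      P0 = ℤ.≤-antisym P≤0 (linear-≤ℤ 0 (ℤ.≤-trans 1≤P (up n')) (identity (P n')))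
        where
        identity : ∀ p → p ℤ.+ 1ℤ ≡ 0ℤ ℤ.+ (p ℤ.+ 1ℤ) ℤ.+ + 0
        identity = ℤSolver.solve-∀
      P1 : P (suc n') ≡ 1ℤ
      P1 = ℤ.≤-antisym (subst (λ p → P (suc n') ℤ.≤ p ℤ.+ 1ℤ) P0 (up n')) 1≤P
      add-back : ∀ p q r → p - q ≡ r → p ≡ r ℤ.+ q
      add-back p q r refl = identity p q
        where
        identity : ∀ p q → p ≡ p - q ℤ.+ q
        identity = ℤSolver.solve-∀
      Pv : P v ≡ + q
      Pv = trans (add-back (P v) (+ q) 0ℤ (trans (sym (Profile-at profile v q)) P0))
        (ℤ.+-identityˡ (+ q))
      locate : ∀ v' → v + v' ≡ s → ∃[ i ] i ∈ ups w × Matches i (suc n')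
      -- Wrapping from `s` to `s + 1` never starts an interval: with `q` at index `s`, the next
      -- value is `- q - (q + 1)`.
      locate zero v+0≡s = contradiction (ℤ.≤-trans (ℤ.≤-reflexive (sym P1))
        (ℤ.≤-trans (ℤ.≤-reflexive P-wrap) (ℤ.neg-≤-pos {q + suc q} {0}))) 1≰0
        where
        v≡s : v ≡ s
        v≡s = trans (sym (ℕ.+-identityʳ v)) v+0≡s
        identity : ∀ q → - q - (1ℤ ℤ.+ q) ≡ - (q ℤ.+ (1ℤ ℤ.+ q))
        identity = ℤSolver.solve-∀
        P-wrap : P (suc n') ≡ - + (q + suc q)
        P-wrap = trans (cong (λ v → P (suc v + q ℕ.* suc s)) v≡s)
          (trans (Profile-at profile 0 (suc q))
          (trans (cong (_- + suc q) (trans (Profile-mirror profile 0 v v≡s) (cong -_ Pv)))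
            (identity (+ q))))
      locate (suc v') eq' with v <? k
      ... | yes v<k = v , rise⇒ups v<k (trans Psv (cong (ℤ._+ 1ℤ) (sym Pv))) , inj₁ (q , refl , Pv)
        where
        Psv : P (suc v) ≡ + q ℤ.+ 1ℤ
        Psv = trans (add-back (P (suc v)) (+ q) 1ℤ (trans (sym (Profile-at profile (suc v) q)) P1))
          (ℤ.+-comm 1ℤ (+ q))
      ... | no v≮k  = v' , rise⇒ups v'<k
        (trans Psv' (trans (identity (+ q)) (cong (ℤ._+ 1ℤ) (sym Pv')))) ,
          inj₂ (q , trans (rearrange v v' (q ℕ.* suc s)) (cong (_+ q ℕ.* suc s) eq') , Pv')
        where
        identity : ∀ q → - q ≡ - (1ℤ ℤ.+ q) ℤ.+ 1ℤ
        identity = ℤSolver.solve-∀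
        rearrange : ∀ v v' x → suc (v + x) + v' ≡ v + suc v' + x
        rearrange = ℕSolver.solve-∀
        opposite : v' + suc v ≡ s
        opposite = trans (ℕ.+-comm v' (suc v)) (trans (sym (ℕ.+-suc v v')) eq')
        Pv' : P v' ≡ -[1+ q ]
        Pv' = trans (Profile-mirror profile v' (suc v) opposite)
          (cong -_ (add-back (P (suc v)) (+ q) 1ℤ (trans (sym (Profile-at profile (suc v) q)) P1)))
        Psv' : P (suc v') ≡ - + q
        Psv' = trans (Profile-mirror profile (suc v') v (trans (ℕ.+-comm (suc v') v) eq'))
          (cong -_ Pv)
        -- For odd `s` the middle step belongs to neither half; its two heights are 0, so it cannot
        -- be the rise in question.
        v'<k : v' < k
        v'<k with v' <? k
        ... | yes lt = lt
        ... | no v'≮k = contradiction (trans (sym Pv') vanishing) λ ()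
          where
          zero-height : ∀ {v} → k ≤ v → height (drop v w) ≡ 0ℤ
          zero-height k≤v = height-beyond w (subst (_≤ _) (sym len) k≤v)
          vanishing : P v' ≡ 0ℤ
          vanishing = trans (wordProfile-small nonzero len adm v' (suc v) opposite)
            (trans (wordHeight-split s w v' (suc v) opposite)
            (cong₂ _-_ (zero-height (ℕ.≮⇒≥ v'≮k)) (zero-height (ℕ.m≤n⇒m≤1+n (ℕ.≮⇒≥ v≮k)))))

    starts⇒ups : ∀ {n} → n ∈ starts as → ∃[ i ] i ∈ ups w × Matches i n
    starts⇒ups {n} n∈ with to (∈-starts (support-decreasing s w) n) n∈
    ... | n∈as , n' , refl , n'∉as =
      periodically s (λ n' → suc n' ∈ as → n' ∉ as → ∃[ i ] i ∈ ups w × Matches i (suc n')) start⇒up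
        n' n∈as n'∉as

    residue : ∀ {a b} q q' → a ≤ s → b ≤ s → a + q ℕ.* suc s ≡ b + q' ℕ.* suc s → a ≡ b
    residue {a} {b} q q' a≤s b≤s eq = trans (sym (remainder a≤s q))
      (trans (cong (_% suc s) eq) (remainder b≤s q'))
      where
      remainder : ∀ {a} → a ≤ s → ∀ q → (a + q ℕ.* suc s) % suc s ≡ a
      remainder {a} a≤s q = trans ([m+kn]%n≡m%n a q (suc s)) (m≤n⇒m%n≡m a≤s)

    k≤s : k ≤ s
    k≤s = ℕ.m≤m+n k (k + e)

    -- Modulo `s + 1` a direct match has residue at most `k`, whereas a mirrored one has residue
    -- `s - i'`, above `k`.
    opposite-sides : ∀ i i' q q' → i < k → i' < k → suc i + q ℕ.* suc s + i' ≡ s + q' ℕ.* suc s → ⊥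
    opposite-sides i i' q q' i<k i'<k eq = ℕ.<-irrefl
      (residue q q' (ℕ.<⇒≤ small) ℕ.≤-refl (trans (rearrange i i' (q ℕ.* suc s)) eq)) small
      where
      rearrange : ∀ i i' x → suc i + i' + x ≡ suc i + x + i'
      rearrange = ℕSolver.solve-∀
      small : suc i + i' < s
      small = ℕ.<-≤-trans (ℕ.+-mono-≤-< i<k i'<k) (ℕ.+-monoʳ-≤ k (ℕ.m≤m+n k e))

    matches-injectiveˡ : ∀ {i i' n} → i < k → i' < k → Matches i n → Matches i' n → i ≡ i'
    matches-injectiveˡ i<k i'<k (inj₁ (q , refl , _)) (inj₁ (q' , eq , _)) =
      ℕ.suc-injective (residue q q' (ℕ.≤-trans i<k k≤s) (ℕ.≤-trans i'<k k≤s) eq)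
    matches-injectiveˡ {i} {i'} {n} i<k i'<k (inj₂ (q , eq , _)) (inj₂ (q' , eq' , _)) =
      residue q' q (ℕ.≤-trans (ℕ.<⇒≤ i<k) k≤s) (ℕ.≤-trans (ℕ.<⇒≤ i'<k) k≤s)
        (ℕ.+-cancelˡ-≡ s _ _ (begin
        s + (i + q' ℕ.* suc s)   ≡⟨ swap s i (q' ℕ.* suc s) ⟩
        s + q' ℕ.* suc s + i     ≡⟨ cong (_+ i) eq' ⟨
        n + i' + i               ≡⟨ swap' n i' i ⟩
        n + i + i'               ≡⟨ cong (_+ i') eq ⟩
        s + q ℕ.* suc s + i'     ≡⟨ swap s i' (q ℕ.* suc s) ⟨
        s + (i' + q ℕ.* suc s)   ∎))
      where
      open ≡-Reasoning
      swap : ∀ s i x → s + (i + x) ≡ s + x + i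
      swap = ℕSolver.solve-∀
      swap' : ∀ n i j → n + i + j ≡ n + j + i
      swap' = ℕSolver.solve-∀
    matches-injectiveˡ {i} {i'} i<k i'<k (inj₁ (q , refl , _)) (inj₂ (q' , eq , _)) =
      ⊥-elim (opposite-sides i i' q q' i<k i'<k eq)
    matches-injectiveˡ {i} {i'} i<k i'<k (inj₂ (q , eq , _)) (inj₁ (q' , refl , _)) =
      ⊥-elim (opposite-sides i' i q' q i'<k i<k eq)

    matches-injectiveʳ : ∀ {i n n'} → Matches i n → Matches i n' → n ≡ n'
    matches-injectiveʳ (inj₁ (q , refl , Pi)) (inj₁ (q' , refl , Pi')) with trans (sym Pi) Pi'
    ... | refl = refl
    matches-injectiveʳ {i} (inj₂ (q , eq , Pi)) (inj₂ (q' , eq' , Pi')) with trans (sym Pi) Pi'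
    ... | refl = ℕ.+-cancelʳ-≡ i _ _ (trans eq (sym eq'))
    matches-injectiveʳ (inj₁ (q , _ , Pi)) (inj₂ (q' , _ , Pi')) =
      contradiction (trans (sym Pi) Pi') λ ()
    matches-injectiveʳ (inj₂ (q , _ , Pi)) (inj₁ (q' , _ , Pi')) =
      contradiction (trans (sym Pi) Pi') λ ()

    length-starts : length (starts as) ≡ length (ups w)
    length-starts = ℕ.≤-antisym
      (length-≤-by (λ n i → Matches i n) (starts-unique (support-decreasing s w)) starts⇒ups
        (λ _ _ → matches-injectiveʳ))
      (length-≤-by Matches (ups-unique w) ups⇒starts
        (λ i∈ i'∈ → matches-injectiveˡ (proj₁ (ups⇒rise i∈)) (proj₁ (ups⇒rise i'∈))))

    origin-support : origin as ≡ c
    origin-support with 0 ∈? as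
    ... | yes 0∈ = one adm (subst (1ℤ ℤ.≤_) P₀ (to (support-represents 0) 0∈))
      where
      one : ∀ {c} → Admissible e w c → 1ℤ ℤ.≤ + c → 1 ≡ c
      one (outside _ _) (+≤+ ())
      one (inside _ _)  _ = refl
    ... | no 0∉  = none adm (0∉ ∘ from (support-represents 0) ∘ subst (1ℤ ℤ.≤_) (sym P₀))
      where
      none : ∀ {c} → Admissible e w c → ¬ 1ℤ ℤ.≤ + c → 0 ≡ c
      none (outside _ _) _ = refl
      none (inside _ _)  h = contradiction ℤ.≤-refl h

  support-core : QuadrupleCoreSet s (support s w)
  support-core = profile⇒quadrupleCoreSet profile support-represents

  corners-support : corners (selfConj (support s w)) ≡ c + (length (ups w) + length (ups w))
  corners-support = trans (corners-selfConj (support-decreasing s w))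
    (cong₂ _+_ origin-support (cong₂ _+_ length-starts length-starts))

  height-from-profile : ∀ {v} → v ≤ k → height (drop v w) ≡ wordProfile s w v
  height-from-profile v≤k = sym (P-left v≤k)

-- Counting words

rises falls plains : Word → ℕ

rises []      = 0
rises (U ∷ w) = suc (rises w)
rises (F ∷ w) = rises w
rises (D ∷ w) = rises w

falls []      = 0
falls (U ∷ w) = falls w
falls (F ∷ w) = falls w
falls (D ∷ w) = suc (falls w)

plains []      = 0
plains (U ∷ w) = plains w
plains (F ∷ w) = suc (plains w)
plains (D ∷ w) = suc (plains w)

length-ups : ∀ w → length (ups w) ≡ rises w
length-ups []      = refl
length-ups (U ∷ w) = cong suc (trans (List.length-map suc (ups w)) (length-ups w))
length-ups (F ∷ w) = trans (List.length-map suc (ups w)) (length-ups w)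
length-ups (D ∷ w) = trans (List.length-map suc (ups w)) (length-ups w)

length-plains : ∀ w → plains w + rises w ≡ length w
length-plains []      = refl
length-plains (U ∷ w) = trans (ℕ.+-suc (plains w) (rises w)) (cong suc (length-plains w))
length-plains (F ∷ w) = cong suc (length-plains w)
length-plains (D ∷ w) = cong suc (length-plains w)

falls≤plains : ∀ w → falls w ≤ plains w
falls≤plains []      = z≤n
falls≤plains (U ∷ w) = falls≤plains w
falls≤plains (F ∷ w) = ℕ.m≤n⇒m≤1+n (falls≤plains w)
falls≤plains (D ∷ w) = s≤s (falls≤plains w)

height-falls : ∀ w → height w ℤ.+ + rises w ≡ + falls w
height-falls []      = refl
height-falls (U ∷ w) = trans (identity (height w) (+ rises w)) (height-falls w)
  where
  identity : ∀ h r → h - 1ℤ ℤ.+ (1ℤ ℤ.+ r) ≡ h ℤ.+ r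
  identity = ℤSolver.solve-∀
height-falls (F ∷ w) = height-falls w
height-falls (D ∷ w) = trans (identity (height w) (+ rises w))
  (cong (λ x → 1ℤ ℤ.+ x) (height-falls w))
  where
  identity : ∀ h r → h ℤ.+ 1ℤ ℤ.+ r ≡ 1ℤ ℤ.+ (h ℤ.+ r)
  identity = ℤSolver.solve-∀

Tally : ℕ → ℕ → ℕ → Word → Set
Tally p r d w = plains w ≡ p × rises w ≡ r × falls w ≡ d

-- The possible endings after the last letter other than `U`: nothing, or a single `U` when `s` is
-- odd.
finalWords : ℕ → ℕ → List Word
finalWords _       zero          = [] ∷ []
finalWords (suc _) (suc zero)    = (U ∷ []) ∷ []
finalWords _       (suc _)       = []

-- After the parity come the numbers of `Tally`: letters other than `U`, rises, falls.
freeWords plainWords fallWords : ℕ → ℕ → ℕ → ℕ → List Word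
climbWords : ℕ → ℕ → ℕ → ℕ → List Word

freeWords e zero    r zero    = finalWords e r
freeWords e zero    r (suc d) = []
freeWords e (suc p) r d       = plainWords e p r d ++ climbWords e p r d

-- The number of letters other than U is suc p, not p.
plainWords e p r d = map (F ∷_) (freeWords e p r d) ++ fallWords e p r d

fallWords e p r zero    = []
fallWords e p r (suc d) = map (D ∷_) (freeWords e p r d)

climbWords e p zero    d = []
climbWords e p (suc r) d = map (U ∷_) (plainWords e p r d)

freeWords-sound : ∀ {e} → e ≤ 1 → ∀ p r d {w} → w ∈ freeWords e p r d → Free e w × Tally p r d w
plainWords-sound : ∀ {e} → e ≤ 1 → ∀ p r d {w} → w ∈ plainWords e p r d → Plain e w ×
  Tally (suc p) r d w

freeWords-sound e≤1       zero    zero          zero (here refl) = empty , refl , refl , refl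
freeWords-sound (s≤s z≤n) zero    (suc zero)    zero (here refl) = last refl , refl , refl , refl
freeWords-sound z≤n       zero    (suc r)       zero ()
freeWords-sound (s≤s z≤n) zero    (suc (suc r)) zero ()
freeWords-sound {e} e≤1   (suc p) r             d    w∈ with ∈-++⁻ (plainWords e p r d) w∈
... | inj₁ w∈p = let pl , t = plainWords-sound e≤1 p r d w∈p in plain pl , t
... | inj₂ w∈c = climbs r w∈c
  where
  climbs : ∀ r {w} → w ∈ climbWords e p r d → Free e w × Tally (suc p) r d w
  climbs (suc r) w∈ with ∈-map⁻ (U ∷_) w∈
  ... | w' , w'∈ , refl = let pl , t₁ , t₂ , t₃ = plainWords-sound e≤1 p r d w'∈ in climb pl , t₁ , cong suc t₂ , t₃

plainWords-sound {e} e≤1 p r d w∈ with ∈-++⁻ (map (F ∷_) (freeWords e p r d)) w∈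
... | inj₁ w∈f with ∈-map⁻ (F ∷_) w∈f
...   | w' , w'∈ , refl = let f , t₁ , t₂ , t₃ = freeWords-sound e≤1 p r d w'∈ in flat f , cong suc t₁ , t₂ , t₃
plainWords-sound {e} e≤1 p r (suc d) w∈ | inj₂ w∈d with ∈-map⁻ (D ∷_) w∈d
...   | w' , w'∈ , refl = let f , t₁ , t₂ , t₃ = freeWords-sound e≤1 p r d w'∈ in fall f , cong suc t₁ , t₂ , cong suc t₃

freeWords-complete : ∀ {e w} → Free e w → w ∈ freeWords e (plains w) (rises w) (falls w)
plainWords-complete : ∀ {e w} → Plain e w → ∃[ p ] plains w ≡ suc p × w ∈ plainWords e p (rises w)
  (falls w)

freeWords-complete empty       = here refl
freeWords-complete (last refl) = here refl
freeWords-complete {e} {w} (plain pl) with plainWords-complete pl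
... | p , eq , w∈ = subst (λ n → w ∈ freeWords e n (rises w) (falls w)) (sym eq) (∈-++⁺ˡ w∈)
freeWords-complete {e} {U ∷ w} (climb pl) with plainWords-complete pl
... | p , eq , w∈ = subst (λ n → U ∷ w ∈ freeWords e n (suc (rises w)) (falls w)) (sym eq)
  (∈-++⁺ʳ (plainWords e p (suc (rises w)) (falls w)) (∈-map⁺ (U ∷_) w∈))

plainWords-complete (flat f) = _ , refl , ∈-++⁺ˡ (∈-map⁺ (F ∷_) (freeWords-complete f))
plainWords-complete {e} {D ∷ w} (fall f) = _ , refl ,
  ∈-++⁺ʳ (map (F ∷_) (freeWords e (plains w) (rises w) (suc (falls w))))
    (∈-map⁺ (D ∷_) (freeWords-complete f))

∷-disjoint : ∀ {x y : Letter} {vs ws} → x ≢ y → Disjoint (map (x ∷_) vs) (map (y ∷_) ws)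
∷-disjoint {x} {y} x≢y (v∈ , w∈) with ∈-map⁻ (x ∷_) v∈ | ∈-map⁻ (y ∷_) w∈
... | _ , _ , refl | _ , _ , eq = x≢y (List.∷-injectiveˡ eq)

freeWords-unique : ∀ e p r d → Unique (freeWords e p r d)
plainWords-unique : ∀ e p r d → Unique (plainWords e p r d)

freeWords-unique e       zero zero          zero    = [] ∷ []
freeWords-unique zero    zero (suc r)       zero    = []
freeWords-unique (suc e) zero (suc zero)    zero    = [] ∷ []
freeWords-unique (suc e) zero (suc (suc r)) zero    = []
freeWords-unique e       zero r             (suc d) = []
freeWords-unique e       (suc p) zero       d       = Unique.++⁺ (plainWords-unique e p 0 d) []
  λ { (_ , ()) }
freeWords-unique e       (suc p) (suc r)    d       = Unique.++⁺ (plainWords-unique e p (suc r) d)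
  (Unique.map⁺ List.∷-injectiveʳ (plainWords-unique e p r d)) (disjoint d)
  where
  disjoint : ∀ d → Disjoint (plainWords e p (suc r) d) (map (U ∷_) (plainWords e p r d))
  disjoint d {w} (w∈ , w∈') with ∈-++⁻ (map (F ∷_) (freeWords e p (suc r) d)) w∈
  ... | inj₁ w∈f = ∷-disjoint (λ ()) (w∈f , w∈')
  disjoint (suc d) (w∈ , w∈') | inj₂ w∈d = ∷-disjoint (λ ()) (w∈d , w∈')

plainWords-unique e p r zero    =
  Unique.++⁺ (Unique.map⁺ List.∷-injectiveʳ (freeWords-unique e p r 0)) [] λ { (_ , ()) }
plainWords-unique e p r (suc d) =
  Unique.++⁺ (Unique.map⁺ List.∷-injectiveʳ (freeWords-unique e p r (suc d)))
  (Unique.map⁺ List.∷-injectiveʳ (freeWords-unique e p r d)) (∷-disjoint λ ())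

-- Falls are chosen among the letters other than `U`. Rises go into different gaps in front of these
-- letters, and for `e ≡ 1` also into the gap at the end, giving `p + e` gaps. A plain word has one
-- more such letter but loses the gap in front of the first. Both choices are independent, each with
-- its own Pascal recursion.
length-freeWords : ∀ {e} → e ≤ 1 → ∀ p r d → length (freeWords e p r d) ≡ (p choose d)
  ℕ.* ((p + e) choose r)
length-plainWords : ∀ {e} → e ≤ 1 → ∀ p r d → length (plainWords e p r d) ≡ (suc p choose d)
  ℕ.* ((p + e) choose r)

length-freeWords z≤n       zero zero          zero    = refl
length-freeWords z≤n       zero (suc r)       zero    =
  sym (cong (1 ℕ.*_) (k>n⇒nCk≡0 {0} {suc r} (s≤s z≤n)))
length-freeWords (s≤s z≤n) zero zero          zero    = refl
length-freeWords (s≤s z≤n) zero (suc zero)    zero    = refl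
length-freeWords (s≤s z≤n) zero (suc (suc r)) zero    =
  sym (cong (1 ℕ.*_) (k>n⇒nCk≡0 {1} {suc (suc r)} (s≤s (s≤s z≤n))))
length-freeWords {e} e≤1   zero r             (suc d) =
  sym (cong (ℕ._* (e choose r)) (k>n⇒nCk≡0 {0} {suc d} (s≤s z≤n)))
length-freeWords {e} e≤1   (suc p) r          d       = trans (List.length-++ (plainWords e p r d))
  (trans (cong (_+ length (climbWords e p r d)) (length-plainWords e≤1 p r d)) (add r))
  where
  add : ∀ r → (suc p choose d) ℕ.* ((p + e) choose r) + length (climbWords e p r d)
    ≡ (suc p choose d) ℕ.* ((suc p + e) choose r)
  add zero    = ℕ.+-identityʳ _
  add (suc r) = begin
    (suc p choose d) ℕ.* ((p + e) choose suc r) + length (map (U ∷_) (plainWords e p r d))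
      ≡⟨ cong (λ l → (suc p choose d) ℕ.* ((p + e) choose suc r) + l)
        (trans (List.length-map (U ∷_) (plainWords e p r d)) (length-plainWords e≤1 p r d)) ⟩
    (suc p choose d) ℕ.* ((p + e) choose suc r) + (suc p choose d) ℕ.* ((p + e) choose r)
      ≡⟨ ℕ.*-distribˡ-+ (suc p choose d) ((p + e) choose suc r) ((p + e) choose r) ⟨
    (suc p choose d) ℕ.* ((p + e) choose suc r + (p + e) choose r)
      ≡⟨ cong ((suc p choose d) ℕ.*_) (trans (ℕ.+-comm ((p + e) choose suc r) ((p + e) choose r))
        (nCk+nC[k+1]≡[n+1]C[k+1] (p + e) r)) ⟩
    (suc p choose d) ℕ.* ((suc p + e) choose suc r) ∎
    where open ≡-Reasoning

length-plainWords {e} e≤1 p r d = trans (List.length-++ (map (F ∷_) (freeWords e p r d)))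
  (trans (cong (_+ length (fallWords e p r d)) (trans (List.length-map (F ∷_) (freeWords e p r d))
    (length-freeWords e≤1 p r d))) (add d))
  where
  add : ∀ d → (p choose d) ℕ.* ((p + e) choose r) + length (fallWords e p r d) ≡ (suc p choose d)
    ℕ.* ((p + e) choose r)
  add zero    = ℕ.+-identityʳ _
  add (suc d) = begin
    (p choose suc d) ℕ.* ((p + e) choose r) + length (map (D ∷_) (freeWords e p r d))
      ≡⟨ cong (λ l → (p choose suc d) ℕ.* ((p + e) choose r) + l)
        (trans (List.length-map (D ∷_) (freeWords e p r d)) (length-freeWords e≤1 p r d)) ⟩
    (p choose suc d) ℕ.* ((p + e) choose r) + (p choose d) ℕ.* ((p + e) choose r)
      ≡⟨ ℕ.*-distribʳ-+ ((p + e) choose r) (p choose suc d) (p choose d) ⟨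
    (p choose suc d + p choose d) ℕ.* ((p + e) choose r)
      ≡⟨ cong (ℕ._* ((p + e) choose r)) (trans (ℕ.+-comm (p choose suc d) (p choose d))
        (nCk+nC[k+1]≡[n+1]C[k+1] p d)) ⟩
    (suc p choose suc d) ℕ.* ((p + e) choose r) ∎
    where open ≡-Reasoning

-- The bijection between words and partitions

WordOf : ℕ → ℕ → ℕ → Word → Set
WordOf k e m w = length w ≡ k × ∃[ c ] Admissible e w c × c + (rises w + rises w) ≡ m

SelfConjugateCore : ℕ → ℕ → List ℕ → Set
SelfConjugateCore s m p =
    IsPartition p
  × SelfConjugate p
  × IsSimultaneousCore (s ∷ suc s ∷ suc (suc s) ∷ suc (suc (suc s)) ∷ []) p
  × corners p ≡ m

Unique-map : ∀ {A B : Set} {f : A → B} {xs} → (∀ {x y} → x ∈ xs → y ∈ xs → f x ≡ f y → x ≡ y) →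
  Unique xs → Unique (map f xs)
Unique-map inj []         = []
Unique-map inj (x∉ ∷ xs!) =
  All.map⁺ (All.tabulate λ y∈ eq → All.lookup x∉ y∈ (inj (here refl) (there y∈) eq))
  ∷ Unique-map (λ x∈ y∈ → inj (there x∈) (there y∈)) xs!

module _ {k e} (e≤1 : e ≤ 1) (nonzero : 1 ≤ k + e) where

  private
    s : ℕ
    s = k + (k + e)

    toPartition : Word → List ℕ
    toPartition w = selfConj (support s w)

  toPartition-sound : ∀ {m w} → WordOf k e m w → SelfConjugateCore s m (toPartition w)
  toPartition-sound {w = w} (len , c , adm , eq) =
      selfConj-isPartition d
    , selfConj-selfConjugate d
    , (from (core⇔coreSet d s) (proj₁ core)
      ∷ from (core⇔coreSet d (suc s)) (proj₁ (proj₂ core))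
      ∷ from (core⇔coreSet d (suc (suc s))) (proj₁ (proj₂ (proj₂ core)))
      ∷ from (core⇔coreSet d (suc (suc (suc s)))) (proj₂ (proj₂ (proj₂ core))) ∷ [])
    , trans (corners-support nonzero len adm) (trans (cong (λ r → c + (r + r)) (length-ups w)) eq)
    where
    d : Decreasing (support s w)
    d = support-decreasing s w
    core : QuadrupleCoreSet s (support s w)
    core = support-core nonzero len adm

  toPartition-surjective : ∀ {m p} → SelfConjugateCore s m p → ∃[ w ] WordOf k e m w ×
    toPartition w ≡ p
  toPartition-surjective {m} {p} (isP , sc , cores , corners≡) = build (selfConj-surjective isP sc)
    where
    Goal : List ℕ → Set
    Goal p = ∃[ w ] WordOf k e m w × toPartition w ≡ p

    fromWord : ∀ {C as c w} → Decreasing as → corners (selfConj as) ≡ m → Represents C as →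
      length w ≡ k → Admissible e w c → (∀ n → wordProfile s w n ≡ C n) → Goal (selfConj as)
    fromWord {C} {as} {c} {w} d corners≡ rep len adm agree = w , (len , c , adm , count) ,
      cong selfConj support≡
      where
      support≡ : support s w ≡ as
      support≡ = Decreasing-extensional (support-decreasing s w) d λ n →
        ⇔.trans (support-represents nonzero len adm n)
          (subst (λ x → 1ℤ ℤ.≤ x ⇔ n ∈ as) (sym (agree n)) (⇔.sym (rep n)))
      count : c + (rises w + rises w) ≡ m
      count = begin
        c + (rises w + rises w)                    ≡⟨ cong (λ r → c + (r + r)) (length-ups w) ⟨
        c + (length (ups w) + length (ups w))      ≡⟨ corners-support nonzero len adm ⟨
        corners (selfConj (support s w))           ≡⟨ cong (λ as → corners (selfConj as)) support≡ ⟩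
        corners (selfConj as)                      ≡⟨ corners≡ ⟩
        m                                          ∎
        where open ≡-Reasoning

    coreSets : ∀ {as} → Decreasing as → selfConj as ≡ p → QuadrupleCoreSet s as
    coreSets d eq = atCore s (All.lookup cores (here refl))
                  , atCore (suc s) (All.lookup cores (there (here refl)))
                  , atCore (suc (suc s)) (All.lookup cores (there (there (here refl))))
                  , atCore (suc (suc (suc s)))
                    (All.lookup cores (there (there (there (here refl)))))
      where
      atCore : ∀ t → IsCore t p → CoreSet t _
      atCore t core = to (core⇔coreSet d t) (subst (IsCore t) (sym eq) core)

    build : ∃[ as ] Decreasing as × selfConj as ≡ p → Goal p
    build (as , d , eq) = subst Goal eq (withProfile (coreSet⇒profile d (coreSets d eq)))
      where
      withProfile : ∃[ C ] Profile s C × Represents C as → Goal (selfConj as)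
      withProfile (C , profile , rep) = withWord (profile⇒word e≤1 profile)
        where
        withWord : ∃[ c ] ∃[ w ] length w ≡ k × Admissible e w c × (∀ n → wordProfile s w n ≡ C n) →
          Goal (selfConj as)
        withWord (c , w , len , adm , agree) = fromWord d (trans (cong corners eq) corners≡) rep len
          adm agree

  -- The partition gives the diagonal arms, these give the profile on one period, and its first half
  -- gives the heights of all suffixes and hence the letters.
  toPartition-injective : ∀ {m w w'} → WordOf k e m w → WordOf k e m w' →
    toPartition w ≡ toPartition w' → w ≡ w'
  toPartition-injective {m} {w} {w'} (len , c , adm , _) (len' , c' , adm' , _) eq =
    height-injective (trans len (sym len')) heights
    where
    support≡ : support s w ≡ support s w'
    support≡ = selfConj-injective (support-decreasing s w) (support-decreasing s w') eq
    rep : Represents (wordProfile s w) (support s w)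
    rep = support-represents nonzero len adm
    rep' : Represents (wordProfile s w') (support s w)
    rep' = subst (Represents (wordProfile s w')) (sym support≡)
      (support-represents nonzero len' adm')
    profiles : ∀ {v} → v ≤ s → wordProfile s w v ≡ wordProfile s w' v
    profiles {v} v≤s = ℤ.≤-antisym
      (Represents-≤ (wordProfile-isProfile nonzero len adm)
        (wordProfile-isProfile nonzero len' adm') rep rep' v (s ∸ v) (ℕ.m+[n∸m]≡n v≤s))
      (Represents-≤ (wordProfile-isProfile nonzero len' adm')
        (wordProfile-isProfile nonzero len adm) rep' rep v (s ∸ v) (ℕ.m+[n∸m]≡n v≤s))
    heights : ∀ v → height (drop v w) ≡ height (drop v w')
    heights v with v ≤? k
    ... | yes v≤k = trans (height-from-profile nonzero len adm v≤k)
      (trans (profiles (ℕ.≤-trans v≤k (ℕ.m≤m+n k (k + e))))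
        (sym (height-from-profile nonzero len' adm' v≤k)))
    ... | no v≰k  = trans (height-beyond w (subst (_≤ v) (sym len) k≤v))
      (sym (height-beyond w' (subst (_≤ v) (sym len') k≤v)))
      where
      k≤v : k ≤ v
      k≤v = ℕ.<⇒≤ (ℕ.≰⇒> v≰k)

  words⇒partitions : ∀ {m n} → HasCardinality (WordOf k e m) n →
    HasCardinality (SelfConjugateCore s m) n
  words⇒partitions {m} (ws , ws! , spec , len) =
    map toPartition ws , Unique-map injective ws! , (λ p → mk⇔ sound (complete p)) ,
      trans (List.length-map toPartition ws) len
    where
    injective : ∀ {x y} → x ∈ ws → y ∈ ws → toPartition x ≡ toPartition y → x ≡ y
    injective {x} {y} x∈ y∈ = toPartition-injective {m} {x} {y} (to (spec x) x∈) (to (spec y) y∈)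
    sound : ∀ {p} → p ∈ map toPartition ws → SelfConjugateCore s m p
    sound {p} p∈ = image (∈-map⁻ toPartition p∈)
      where
      image : ∃[ w ] w ∈ ws × p ≡ toPartition w → SelfConjugateCore s m p
      image (w , w∈ , eq) = subst (SelfConjugateCore s m) (sym eq)
        (toPartition-sound {m} {w} (to (spec w) w∈))
    complete : ∀ p → SelfConjugateCore s m p → p ∈ map toPartition ws
    complete p core = image (toPartition-surjective {m} {p} core)
      where
      image : ∃[ w ] WordOf k e m w × toPartition w ≡ p → p ∈ map toPartition ws
      image (w , word , eq) = subst (_∈ map toPartition ws) eq
        (∈-map⁺ toPartition (from (spec w) word))

-- The total height is the number of falls minus the number of rises.
Admissible-falls : ∀ {e w c} → Admissible e w c → falls w ≡ c + rises w
Admissible-falls {w = w} adm =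
  ℤ.+-injective (trans (sym (height-falls w)) (cong (ℤ._+ + rises w) (Admissible-height adm)))

odd≢even : ∀ {a b} → suc (a + a) ≢ b + b
odd≢even {a} {zero}  ()
odd≢even {a} {suc b} eq = odd≢even {b} {a} (sym (trans (ℕ.suc-injective eq) (ℕ.+-suc b b)))

double-injective : ∀ {a b} → a + a ≡ b + b → a ≡ b
double-injective {a} {b} eq = trans (ℕ.n≡⌊n+n/2⌋ a) (trans (cong ⌊_/2⌋ eq) (sym (ℕ.n≡⌊n+n/2⌋ b)))

tally-length : ∀ w {p r k} → plains w ≡ p → rises w ≡ r → p + r ≡ k → length w ≡ k
tally-length w refl refl eq = trans (sym (length-plains w)) eq

length-tally : ∀ {w p r k} → length w ≡ k → rises w ≡ r → p + r ≡ k → plains w ≡ p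
length-tally {w} {p} {r} len refl eq =
  ℕ.+-cancelʳ-≡ r _ _ (trans (length-plains w) (trans len (sym eq)))

-- Here `r` stands for `k - m`, to avoid subtraction. The `u` rises leave `u + r` other letters; as
-- `C 0` is 0, `u` of them fall.
words-even : ∀ {e} → e ≤ 1 → ∀ u r →
  HasCardinality (WordOf (u + u + r) e (u + u)) (((u + r) choose u) ℕ.* ((u + r + e) choose u))
words-even {e} e≤1 u r = freeWords e (u + r) u u , freeWords-unique e (u + r) u u ,
  (λ w → mk⇔ (sound w) (complete w)) , length-freeWords e≤1 (u + r) u u
  where
  rearrange : ∀ u r → u + r + u ≡ u + u + r
  rearrange = ℕSolver.solve-∀
  sound : ∀ w → w ∈ freeWords e (u + r) u u → WordOf (u + u + r) e (u + u) w
  sound w w∈ with freeWords-sound e≤1 (u + r) u u w∈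
  ... | free , t₁ , t₂ , t₃ = tally-length w t₁ t₂ (rearrange u r) , 0 , outside free level ,
    cong₂ _+_ t₂ t₂
    where
    level : height w ≡ 0ℤ
    level = trans (identity (height w) (+ u))
      (trans (cong (_- + u) (subst₂ (λ a b → height w ℤ.+ + a ≡ + b) t₂ t₃ (height-falls w)))
      (ℤ.+-inverseʳ (+ u)))
      where
      identity : ∀ h u → h ≡ h ℤ.+ u - u
      identity = ℤSolver.solve-∀
  complete : ∀ w → WordOf (u + u + r) e (u + u) w → w ∈ freeWords e (u + r) u u
  complete w (len , _ , inside _ _ , eq)     = contradiction eq (odd≢even {rises w} {u})
  complete w (len , _ , adm@(outside free _) , eq) = member (double-injective eq)
    where
    member : rises w ≡ u → w ∈ freeWords e (u + r) u u
    member refl = subst₂ (λ p d → w ∈ freeWords e p u d) (length-tally {w} len refl (rearrange u r))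
      (Admissible-falls adm) (freeWords-complete free)

-- Again `r` is `k - m`. An odd `m` forces `C 0` to be 1, hence one fall more than rises and no
-- initial `U`.
words-odd : ∀ {e} → e ≤ 1 → ∀ u r →
  HasCardinality (WordOf (suc (u + u) + r) e (suc (u + u)))
    ((suc (u + r) choose suc u) ℕ.* ((u + r + e) choose u))
words-odd {e} e≤1 u r = plainWords e (u + r) u (suc u) , plainWords-unique e (u + r) u (suc u) ,
  (λ w → mk⇔ (sound w) (complete w)) , length-plainWords e≤1 (u + r) u (suc u)
  where
  rearrange : ∀ u r → suc (u + r) + u ≡ suc (u + u) + r
  rearrange = ℕSolver.solve-∀
  sound : ∀ w → w ∈ plainWords e (u + r) u (suc u) → WordOf (suc (u + u) + r) e (suc (u + u)) w
  sound w w∈ with plainWords-sound e≤1 (u + r) u (suc u) w∈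
  ... | pl , t₁ , t₂ , t₃ = tally-length w t₁ t₂ (rearrange u r) , 1 , inside pl level ,
    cong suc (cong₂ _+_ t₂ t₂)
    where
    level : height w ≡ 1ℤ
    level = trans (identity (height w) (+ u))
      (trans (cong (_- + u) (subst₂ (λ a b → height w ℤ.+ + a ≡ + b) t₂ t₃ (height-falls w)))
      (identity' (+ u)))
      where
      identity : ∀ h u → h ≡ h ℤ.+ u - u
      identity = ℤSolver.solve-∀
      identity' : ∀ u → 1ℤ ℤ.+ u - u ≡ 1ℤ
      identity' = ℤSolver.solve-∀
  complete : ∀ w → WordOf (suc (u + u) + r) e (suc (u + u)) w → w ∈ plainWords e (u + r) u (suc u)
  complete w (len , _ , outside _ _ , eq)  = contradiction (sym eq) (odd≢even {u} {rises w})
  complete w (len , _ , adm@(inside pl _) , eq) = member (double-injective (ℕ.suc-injective eq))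
    where
    member : rises w ≡ u → w ∈ plainWords e (u + r) u (suc u)
    member refl with plainWords-complete pl
    ... | p , plains≡ , w∈ = subst₂ (λ p d → w ∈ plainWords e p u d)
      (ℕ.suc-injective (trans (sym plains≡) (length-tally {w} len refl (rearrange u r))))
        (Admissible-falls adm) w∈

-- `m` is the number of rises plus the number of falls, so it cannot exceed the length.
words-none : ∀ {k e m} → k < m → HasCardinality (WordOf k e m) 0
words-none {k} {e} {m} k<m = [] , [] ,
  (λ w → mk⇔ (λ ()) (λ word → contradiction k<m (ℕ.≤⇒≯ (short w word)))) , refl
  where
  short : ∀ w → WordOf k e m w → m ≤ k
  short w (len , c , adm , refl) = begin
    c + (rises w + rises w)   ≡⟨ ℕ.+-assoc c (rises w) (rises w) ⟨
    c + rises w + rises w     ≡⟨ cong (_+ rises w) (Admissible-falls adm) ⟨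
    falls w + rises w         ≤⟨ ℕ.+-monoˡ-≤ (rises w) (falls≤plains w) ⟩
    plains w + rises w        ≡⟨ length-plains w ⟩
    length w                  ≡⟨ len ⟩
    k                         ∎
    where open ℕ.≤-Reasoning

-- Matching the count with the stated binomial coefficients

data Parity : ℕ → Set where
  even : ∀ u → Parity (u + u)
  odd  : ∀ u → Parity (suc (u + u))

parity : ∀ m → Parity m
parity zero    = even 0
parity (suc m) with parity m
... | even u = odd u
... | odd u  = subst Parity (cong suc (ℕ.+-suc u u)) (even (suc u))

+[m+n]-+m : ∀ {a} m n → a ≡ m + n → + a - + m ≡ + n
+[m+n]-+m m n refl = identity (+ m) (+ n)
  where
  identity : ∀ m n → m ℤ.+ n - m ≡ n
  identity = ℤSolver.solve-∀

choose-symmetric : ∀ a b → (a + b) choose a ≡ (a + b) choose b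
choose-symmetric a b = trans (nCk≡nC[n∸k] (ℕ.m≤m+n a b)) (cong ((a + b) choose_) (ℕ.m+n∸m≡n a b))

binomial-negative : ∀ a {k m} → k < m → binomial a (+ k - + m) ≡ 0ℤ
binomial-negative a {k} {m} k<m =
  trans (cong (binomial a) (trans (ℤ.m-n≡m⊖n k m)
  (trans (ℤ.⊖-< k<m) (cong (λ x → - + x) (gap {k} {m} k<m))))) (vanish a {m ∸ suc k})
  where
  gap : ∀ {k m} → k < m → m ∸ k ≡ suc (m ∸ suc k)
  gap {zero}  {suc m} _         = refl
  gap {suc k} {suc m} (s≤s k<m) = gap k<m
  vanish : ∀ a {n} → binomial a -[1+ n ] ≡ 0ℤ
  vanish (+ _)    = refl
  vanish -[1+ _ ] = refl

words-count : ∀ {e} k → e ≤ 1 → ∀ m → Σ[ n ∈ ℕ ] HasCardinality (WordOf k e m) n ×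
  + n ≡ binomial (+ k - + ⌊ m /2⌋) (+ k - + m) * binomial (+ (k + e) - + ⌊ suc m /2⌋) (+ ⌊ m /2⌋)
words-count {e} k e≤1 m with m ≤? k
... | no m≰k = 0 , words-none (ℕ.≰⇒> m≰k) ,
  -- The first lower entry is negative, so the product vanishes whatever the second factor is.
  sym (trans (cong (_* binomial (+ (k + e) - + ⌊ suc m /2⌋) (+ ⌊ m /2⌋))
    (binomial-negative (+ k - + ⌊ m /2⌋) (ℕ.≰⇒> m≰k)))
    (ℤ.*-zeroˡ (binomial (+ (k + e) - + ⌊ suc m /2⌋) (+ ⌊ m /2⌋))))
... | yes m≤k with ℕ.m≤n⇒∃[o]m+o≡n m≤k | parity m
...   | r , refl | even u = _ , words-even e≤1 u r , (begin
  + (((u + r) choose u) ℕ.* ((u + r + e) choose u))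
    ≡⟨ ℤ.pos-* ((u + r) choose u) ((u + r + e) choose u) ⟩
  + ((u + r) choose u) * + ((u + r + e) choose u)
    ≡⟨ cong (λ x → + x * + ((u + r + e) choose u)) (choose-symmetric u r) ⟩
  binomial (+ (u + r)) (+ r) * binomial (+ (u + r + e)) (+ u)
    ≡⟨ cong₂ _*_ (cong₂ binomial (+[m+n]-+m u (u + r) (ℕ.+-assoc u u r)) (+[m+n]-+m (u + u) r refl))
         (cong (λ a → binomial a (+ u)) (+[m+n]-+m u (u + r + e) (rearrange u r e))) ⟨
  binomial (+ (u + u + r) - + u) (+ (u + u + r) - + (u + u)) * binomial (+ (u + u + r + e) - + u)
    (+ u)
    -- Since `⌈ n /2⌉` unfolds to `⌊ suc n /2⌋`, the floor and ceiling lemmas for `u + u` supply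
    -- both halves.
    ≡⟨ cong₂ (λ a b → binomial (+ (u + u + r) - + a) (+ (u + u + r) - + (u + u)) * binomial
      (+ (u + u + r + e) - + b) (+ a))
         (ℕ.n≡⌊n+n/2⌋ u) (ℕ.n≡⌈n+n/2⌉ u) ⟩
  binomial (+ (u + u + r) - + ⌊ u + u /2⌋) (+ (u + u + r) - + (u + u)) * binomial
    (+ (u + u + r + e) - + ⌊ suc (u + u) /2⌋) (+ ⌊ u + u /2⌋) ∎)
  where
  open ≡-Reasoning
  rearrange : ∀ u r e → u + u + r + e ≡ u + (u + r + e)
  rearrange = ℕSolver.solve-∀
...   | r , refl | odd u = _ , words-odd e≤1 u r , (begin
  + ((suc (u + r) choose suc u) ℕ.* ((u + r + e) choose u))
    ≡⟨ ℤ.pos-* (suc (u + r) choose suc u) ((u + r + e) choose u) ⟩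
  + (suc (u + r) choose suc u) * + ((u + r + e) choose u)
    ≡⟨ cong (λ x → + x * + ((u + r + e) choose u)) (choose-symmetric (suc u) r) ⟩
  binomial (+ (suc (u + r))) (+ r) * binomial (+ (u + r + e)) (+ u)
    ≡⟨ cong₂ _*_ (cong₂ binomial (+[m+n]-+m u (suc (u + r)) (rearrange₁ u r))
      (+[m+n]-+m (suc (u + u)) r refl))
         (cong (λ a → binomial a (+ u)) (+[m+n]-+m (suc u) (u + r + e) (rearrange₂ u r e))) ⟨
  binomial (+ (suc (u + u) + r) - + u) (+ (suc (u + u) + r) - + suc (u + u)) * binomial
    (+ (suc (u + u) + r + e) - + suc u) (+ u)
    ≡⟨ cong₂ (λ a b → binomial (+ (suc (u + u) + r) - + a) (+ (suc (u + u) + r) - + suc (u + u))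
      * binomial (+ (suc (u + u) + r + e) - + suc b) (+ a))
         (ℕ.n≡⌈n+n/2⌉ u) (ℕ.n≡⌊n+n/2⌋ u) ⟩
  binomial (+ (suc (u + u) + r) - + ⌊ suc (u + u) /2⌋) (+ (suc (u + u) + r) - + suc (u + u))
    * binomial (+ (suc (u + u) + r + e) - + ⌊ suc (suc (u + u)) /2⌋) (+ ⌊ suc (u + u) /2⌋) ∎)
  where
  open ≡-Reasoning
  rearrange₁ : ∀ u r → suc (u + u) + r ≡ u + suc (u + r)
  rearrange₁ = ℕSolver.solve-∀
  rearrange₂ : ∀ u r e → suc (u + u) + r + e ≡ suc u + (u + r + e)
  rearrange₂ = ℕSolver.solve-∀

-- `e` is the ceiling minus the floor of half of `s`, that is, the parity of `s`.
halves : ∀ s → ∃[ e ] e ≤ 1 × ⌊ suc s /2⌋ ≡ ⌊ s /2⌋ + e × s ≡ ⌊ s /2⌋ + (⌊ s /2⌋ + e)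
halves s = e , e≤1 , sum , trans (sym (ℕ.⌊n/2⌋+⌈n/2⌉≡n s)) (cong (_+_ ⌊ s /2⌋) sum)
  where
  e : ℕ
  e = ⌊ suc s /2⌋ ∸ ⌊ s /2⌋
  sum : ⌊ suc s /2⌋ ≡ ⌊ s /2⌋ + e
  sum = sym (ℕ.m+[n∸m]≡n (ℕ.⌊n/2⌋≤⌈n/2⌉ s))
  e≤1 : e ≤ 1
  e≤1 = ℕ.m≤n+o⇒m∸n≤o ⌊ suc s /2⌋ ⌊ s /2⌋ (ℕ.≤-trans (ℕ.⌊n/2⌋-mono (ℕ.n≤1+n (suc s)))
    (ℕ.≤-reflexive (ℕ.+-comm 1 ⌊ s /2⌋)))

proposition3p10 : ∀ (s m : ℕ) → .{{_ : NonZero s}} →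
    Σ[ n ∈ ℕ ]
    HasCardinality
    (λ p → IsPartition p
    × SelfConjugate p
    × IsSimultaneousCore
    (s ∷ suc s ∷ suc (suc s) ∷ suc (suc (suc s)) ∷ []) p
    × corners p ≡ m)
    n
    × + n ≡ binomial (+ ⌊ s /2⌋ - + ⌊ m /2⌋) (+ ⌊ s /2⌋ - + m)
    * binomial (+ ⌊ suc s /2⌋ - + ⌊ suc m /2⌋) (+ ⌊ m /2⌋)
proposition3p10 s@(suc _) m with halves s
... | e , e≤1 , sum , s≡ with words-count ⌊ s /2⌋ e≤1 m
...   | n , words , count = n ,
  subst (λ s → HasCardinality (SelfConjugateCore s m) n) (sym s≡)
    -- Positivity of `s` enters as `1 ≤ ⌊ suc s /2⌋`, which is `k + e`; for `s ≡ 1` the half period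
    -- `k` is 0 and `e` is 1.
    (words⇒partitions e≤1 (subst (1 ≤_) sum (s≤s z≤n)) words) ,
  trans count (cong (λ k' → binomial (+ ⌊ s /2⌋ - + ⌊ m /2⌋) (+ ⌊ s /2⌋ - + m) * binomial
    (+ k' - + ⌊ suc m /2⌋) (+ ⌊ m /2⌋)) (sym sum))
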